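{- Every tree $T$ can be realized in $\mathbb{R}^2$; that is, if $T=(U,\mathcal{C})$ is a median set system whose 1-inclusion graph is a tree, then $\dim_{\mathbb{E}}(T)\leq 2$.
   Context: $U$ is a finite set and $\mathcal{C}\subseteq 2^U$. The 1-inclusion graph of $\mathcal{C}$ has vertex set $\mathcal{C}$, two sets being adjacent when their symmetric difference has exactly one element. A median set system is a pair $(U,\mathcal{C})$ satisfying (C1$'$) $\varnothing\in\mathcal{C}$; (C2) $X\cap Y\in\mathcal{C}$ for all $X,Y\in\mathcal{C}$; (C6) for any $x\neq y$ in $U$ there is $K\in\mathcal{C}$ with $|\{x,y\}\cap K|=1$; (C7) if $K_i,M_i\in\mathcal{C}$ ($i=1,2,3$) satisfy $K_i\cup K_j\subseteq M_k$ whenever $\{i,j,k\}=\{1,2,3\}$, then $K_1\cup K_2\cup K_3\in\mathcal{C}$. A set family is called a tree if it is a median set system whose 1-inclusion graph is a tree (a connected acyclic graph). A realization of $\mathcal{C}\subseteq 2^U$ in $\mathbb{R}^m$ consists of oriented affine hyperplanes $(H_e)_{e\in U}$ of $\mathbb{R}^m$, where $H_e=\{x:a_e\cdot x=b_e\}$ with $a_e\neq 0$, $H_e^+=\{x:a_e\cdot x>b_e\}$, $H_e^-=\{x:a_e\cdot x<b_e\}$, and a relatively open convex set $K\subseteq\mathbb{R}^m$ such that $X\subseteq U$ belongs to $\mathcal{C}$ if and only if there is $x\in K$ with $x\in H_e^+$ for all $e\in X$ and $x\in H_e^-$ for all $e\in U\setminus X$. The Euclidean dimension $\dim_{\mathbb{E}}$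 is the smallest $m$ such that a realization in $\mathbb{R}^m$ exists. -}

module Defs where

open import Data.Bool.Base using (Bool; T)
open import Data.Fin.Base using (Fin; zero; suc; inject₁; fromℕ)
open import Data.Fin.Subset using (Subset; _∈_; _∉_; _⊆_; _∩_; _∪_; _─_; ⁅_⁆; ∣_∣) renaming (⊥ to ∅)
open import Data.Fin.Patterns using (0F; 1F; 2F)
open import Data.Nat.Base as ℕ using (ℕ)
import Data.Nat.Properties as ℕ
open import Data.Product using (Σ; ∃; ∃-syntax; Σ-syntax; _×_; _,_; proj₁; proj₂)
open import Data.Rational.Base as ℚ using (ℚ; 0ℚ; 1ℚ; ½)
import Data.Rational.Properties as ℚ
open import Data.Rational.Solver using (module +-*-Solver)
open import Data.Sum.Base using (_⊎_)
open import Data.Vec.Functional using (Vector; foldr)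
open import Function.Bundles using (_⇔_)
open import Function.Definitions using (Injective)
open import Level using (0ℓ)
open import Relation.Binary.Construct.Closure.ReflexiveTransitive using (Star)
open import Relation.Binary.Core using (Rel)
open import Relation.Binary.PropositionalEquality using (_≡_; _≢_; refl; sym; trans; cong; cong₂; subst)
open import Relation.Nullary.Negation.Core using (¬_)

-- Real numbers, as Cauchy sequences of rationals.  Equality is the
-- setoid equality _≈_; every subset of ℝᵐ below is required to respect it.

EventuallyWithin : ℚ → (ℕ → ℚ) → Set
EventuallyWithin ε s =
  ∃[ N ] (∀ m n → N ℕ.≤ m → N ℕ.≤ n → ℚ.∣ s m ℚ.- s n ∣ ℚ.< ε)

IsCauchy : (ℕ → ℚ) → Set
IsCauchy s = ∀ ε → 0ℚ ℚ.< ε → EventuallyWithin ε s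

private

  regroup-+ : ∀ a b c d → (a ℚ.+ b) ℚ.- (c ℚ.+ d) ≡ (a ℚ.- c) ℚ.+ (b ℚ.- d)
  regroup-+ = solve 4 (λ a b c d → (a :+ b) :- (c :+ d) := (a :- c) :+ (b :- d)) refl
    where open +-*-Solver

  regroup-* : ∀ a b c d → (a ℚ.* b) ℚ.- (c ℚ.* d) ≡ a ℚ.* (b ℚ.- d) ℚ.+ (a ℚ.- c) ℚ.* d
  regroup-* = solve 4 (λ a b c d → (a :* b) :- (c :* d) := a :* (b :- d) :+ (a :- c) :* d) refl
    where open +-*-Solver

  regroup-neg : ∀ a b → (ℚ.- a) ℚ.- (ℚ.- b) ≡ ℚ.- (a ℚ.- b)
  regroup-neg = solve 2 (λ a b → (:- a) :- (:- b) := :- (a :- b)) refl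
    where open +-*-Solver

  split : ∀ a b → a ≡ (a ℚ.- b) ℚ.+ b
  split = solve 2 (λ a b → a := (a :- b) :+ b) refl
    where open +-*-Solver

  halves : ∀ ε → ε ℚ.* ½ ℚ.+ ε ℚ.* ½ ≡ ε
  halves ε = trans (sym (ℚ.*-distribˡ-+ ε ½ ½)) (ℚ.*-identityʳ ε)

  *-pos : ∀ {p q} → 0ℚ ℚ.< p → 0ℚ ℚ.< q → 0ℚ ℚ.< p ℚ.* q
  *-pos {p} {q} 0<p 0<q = ℚ.positive⁻¹ (p ℚ.* q)
    {{ℚ.pos*pos⇒pos p {{ℚ.positive 0<p}} q {{ℚ.positive 0<q}}}}

  Bounded : (ℕ → ℚ) → Set
  Bounded s = ∃[ B ] (0ℚ ℚ.< B) × ∃[ N ] (∀ n → N ℕ.≤ n → ℚ.∣ s n ∣ ℚ.≤ B)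

  bounded : ∀ s → IsCauchy s → Bounded s
  bounded s c with c 1ℚ (ℚ.positive⁻¹ 1ℚ)
  ... | N , close = 1ℚ ℚ.+ ℚ.∣ s N ∣
      , ℚ.+-mono-<-≤ (ℚ.positive⁻¹ 1ℚ) (ℚ.0≤∣p∣ (s N))
      , N
      , λ n N≤n → begin
          ℚ.∣ s n ∣                         ≡⟨ cong ℚ.∣_∣ (split (s n) (s N)) ⟩
          ℚ.∣ (s n ℚ.- s N) ℚ.+ s N ∣       ≤⟨ ℚ.∣p+q∣≤∣p∣+∣q∣ (s n ℚ.- s N) (s N) ⟩
          ℚ.∣ s n ℚ.- s N ∣ ℚ.+ ℚ.∣ s N ∣   ≤⟨ ℚ.+-monoˡ-≤ ℚ.∣ s N ∣ (ℚ.<⇒≤ (close n N N≤n ℕ.≤-refl)) ⟩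
          1ℚ ℚ.+ ℚ.∣ s N ∣                  ∎
    where open ℚ.≤-Reasoning

  scale-to : ∀ B ε → 0ℚ ℚ.< B → 0ℚ ℚ.< ε → ∃[ δ ] (0ℚ ℚ.< δ) × (B ℚ.* δ ≡ ε)
  scale-to B ε 0<B 0<ε = B⁻¹ ℚ.* ε
    , *-pos (ℚ.positive⁻¹ B⁻¹ {{ℚ.1/pos⇒pos B {{ℚ.positive 0<B}}}}) 0<ε
    , trans (sym (ℚ.*-assoc B B⁻¹ ε))
        (trans (cong (ℚ._* ε) (ℚ.*-inverseʳ B {{B≢0}})) (ℚ.*-identityˡ ε))
    where
    B≢0 = ℚ.pos⇒nonZero B {{ℚ.positive 0<B}}
    B⁻¹ = ℚ.1/_ B {{B≢0}}

  *-difference-< : ∀ a b c d A B δ → 0ℚ ℚ.< A → 0ℚ ℚ.< B →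
    ℚ.∣ a ∣ ℚ.≤ A → ℚ.∣ d ∣ ℚ.≤ B → ℚ.∣ a ℚ.- c ∣ ℚ.< δ → ℚ.∣ b ℚ.- d ∣ ℚ.< δ →
    ℚ.∣ a ℚ.* b ℚ.- c ℚ.* d ∣ ℚ.< (A ℚ.+ B) ℚ.* δ
  *-difference-< a b c d A B δ 0<A 0<B ∣a∣≤A ∣d∣≤B ∣a-c∣<δ ∣b-d∣<δ = begin-strict
    ℚ.∣ a ℚ.* b ℚ.- c ℚ.* d ∣
      ≡⟨ cong ℚ.∣_∣ (regroup-* a b c d) ⟩
    ℚ.∣ a ℚ.* (b ℚ.- d) ℚ.+ (a ℚ.- c) ℚ.* d ∣
      ≤⟨ ℚ.∣p+q∣≤∣p∣+∣q∣ (a ℚ.* (b ℚ.- d)) ((a ℚ.- c) ℚ.* d) ⟩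
    ℚ.∣ a ℚ.* (b ℚ.- d) ∣ ℚ.+ ℚ.∣ (a ℚ.- c) ℚ.* d ∣
      ≡⟨ cong₂ ℚ._+_ (ℚ.∣p*q∣≡∣p∣*∣q∣ a (b ℚ.- d)) (ℚ.∣p*q∣≡∣p∣*∣q∣ (a ℚ.- c) d) ⟩
    ℚ.∣ a ∣ ℚ.* ℚ.∣ b ℚ.- d ∣ ℚ.+ ℚ.∣ a ℚ.- c ∣ ℚ.* ℚ.∣ d ∣
      ≤⟨ ℚ.+-mono-≤
           (ℚ.*-monoʳ-≤-nonNeg ℚ.∣ b ℚ.- d ∣ {{ℚ.∣-∣-nonNeg (b ℚ.- d)}} ∣a∣≤A)
           (ℚ.*-monoˡ-≤-nonNeg ℚ.∣ a ℚ.- c ∣ {{ℚ.∣-∣-nonNeg (a ℚ.- c)}} ∣d∣≤B) ⟩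
    A ℚ.* ℚ.∣ b ℚ.- d ∣ ℚ.+ ℚ.∣ a ℚ.- c ∣ ℚ.* B
      <⟨ ℚ.+-mono-<
           (ℚ.*-monoʳ-<-pos A {{ℚ.positive 0<A}} ∣b-d∣<δ)
           (ℚ.*-monoˡ-<-pos B {{ℚ.positive 0<B}} ∣a-c∣<δ) ⟩
    A ℚ.* δ ℚ.+ δ ℚ.* B
      ≡⟨ cong (A ℚ.* δ ℚ.+_) (ℚ.*-comm δ B) ⟩
    A ℚ.* δ ℚ.+ B ℚ.* δ
      ≡⟨ ℚ.*-distribʳ-+ δ A B ⟨
    (A ℚ.+ B) ℚ.* δ ∎
    where open ℚ.≤-Reasoning

  -- Abstract, since otherwise normalising a term of type ℝ expands these proofs.
  abstract

    const-cauchy : ∀ q → IsCauchy (λ _ → q)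
    const-cauchy q ε 0<ε = 0 , λ _ _ _ _ →
      subst (ℚ._< ε) (sym (cong ℚ.∣_∣ (ℚ.+-inverseʳ q))) 0<ε

    +-cauchy : ∀ s t → IsCauchy s → IsCauchy t → IsCauchy (λ n → s n ℚ.+ t n)
    +-cauchy s t cs ct ε 0<ε = combine (cs (ε ℚ.* ½) 0<ε½) (ct (ε ℚ.* ½) 0<ε½)
      where
      open ℚ.≤-Reasoning
      0<ε½ : 0ℚ ℚ.< ε ℚ.* ½
      0<ε½ = *-pos 0<ε (ℚ.positive⁻¹ ½)

      combine : EventuallyWithin (ε ℚ.* ½) s → EventuallyWithin (ε ℚ.* ½) t →
        EventuallyWithin ε (λ n → s n ℚ.+ t n)
      combine (M , closeˢ) (N , closeᵗ) = M ℕ.⊔ N , λ m n ≤m ≤n → begin-strict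
        ℚ.∣ (s m ℚ.+ t m) ℚ.- (s n ℚ.+ t n) ∣        ≡⟨ cong ℚ.∣_∣ (regroup-+ (s m) (t m) (s n) (t n)) ⟩
        ℚ.∣ (s m ℚ.- s n) ℚ.+ (t m ℚ.- t n) ∣        ≤⟨ ℚ.∣p+q∣≤∣p∣+∣q∣ (s m ℚ.- s n) (t m ℚ.- t n) ⟩
        ℚ.∣ s m ℚ.- s n ∣ ℚ.+ ℚ.∣ t m ℚ.- t n ∣      <⟨ ℚ.+-mono-<
            (closeˢ m n (ℕ.m⊔n≤o⇒m≤o M N ≤m) (ℕ.m⊔n≤o⇒m≤o M N ≤n))
            (closeᵗ m n (ℕ.m⊔n≤o⇒n≤o M N ≤m) (ℕ.m⊔n≤o⇒n≤o M N ≤n)) ⟩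
        ε ℚ.* ½ ℚ.+ ε ℚ.* ½                          ≡⟨ halves ε ⟩
        ε                                            ∎

    neg-cauchy : ∀ s → IsCauchy s → IsCauchy (λ n → ℚ.- s n)
    neg-cauchy s c ε 0<ε with c ε 0<ε
    ... | N , close = N , λ m n N≤m N≤n →
      subst (ℚ._< ε)
        (sym (trans (cong ℚ.∣_∣ (regroup-neg (s m) (s n))) (ℚ.∣-p∣≡∣p∣ (s m ℚ.- s n))))
        (close m n N≤m N≤n)

    *-cauchy : ∀ s t → IsCauchy s → IsCauchy t → IsCauchy (λ n → s n ℚ.* t n)
    *-cauchy s t cs ct ε 0<ε = choose (bounded s cs) (bounded t ct)
      where
      combine : ∀ A B δ → 0ℚ ℚ.< A → 0ℚ ℚ.< B → (A ℚ.+ B) ℚ.* δ ≡ ε →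
        ∀ K L → (∀ n → K ℕ.≤ n → ℚ.∣ s n ∣ ℚ.≤ A) → (∀ n → L ℕ.≤ n → ℚ.∣ t n ∣ ℚ.≤ B) →
        EventuallyWithin δ s → EventuallyWithin δ t → EventuallyWithin ε (λ n → s n ℚ.* t n)
      combine A B δ 0<A 0<B eq K L boundˢ boundᵗ (M , closeˢ) (N , closeᵗ) =
        (K ℕ.⊔ L) ℕ.⊔ (M ℕ.⊔ N) , λ m n ≤m ≤n →
          let K⊔L≤m = ℕ.m⊔n≤o⇒m≤o (K ℕ.⊔ L) (M ℕ.⊔ N) ≤m
              K⊔L≤n = ℕ.m⊔n≤o⇒m≤o (K ℕ.⊔ L) (M ℕ.⊔ N) ≤n
              M⊔N≤m = ℕ.m⊔n≤o⇒n≤o (K ℕ.⊔ L) (M ℕ.⊔ N) ≤m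
              M⊔N≤n = ℕ.m⊔n≤o⇒n≤o (K ℕ.⊔ L) (M ℕ.⊔ N) ≤n
          in subst (ℚ.∣ s m ℚ.* t m ℚ.- s n ℚ.* t n ∣ ℚ.<_) eq
               (*-difference-< (s m) (t m) (s n) (t n) A B δ 0<A 0<B
                 (boundˢ m (ℕ.m⊔n≤o⇒m≤o K L K⊔L≤m))
                 (boundᵗ n (ℕ.m⊔n≤o⇒n≤o K L K⊔L≤n))
                 (closeˢ m n (ℕ.m⊔n≤o⇒m≤o M N M⊔N≤m) (ℕ.m⊔n≤o⇒m≤o M N M⊔N≤n))
                 (closeᵗ m n (ℕ.m⊔n≤o⇒n≤o M N M⊔N≤m) (ℕ.m⊔n≤o⇒n≤o M N M⊔N≤n)))

      choose : Bounded s → Bounded t → EventuallyWithin ε (λ n → s n ℚ.* t n)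
      choose (A , 0<A , K , boundˢ) (B , 0<B , L , boundᵗ) =
        let δ , 0<δ , eq = scale-to (A ℚ.+ B) ε (ℚ.+-mono-< 0<A 0<B) 0<ε
        in combine A B δ 0<A 0<B eq K L boundˢ boundᵗ (cs δ 0<δ) (ct δ 0<δ)

record ℝ : Set where
  constructor real
  field
    seq    : ℕ → ℚ
    cauchy : IsCauchy seq

open ℝ public

infix  4 _≈_ _<_ _≤_ _#_
infixl 6 _+_ _-_
infixl 7 _*_
infix  8 -_

fromℚ : ℚ → ℝ
fromℚ q = real (λ _ → q) (const-cauchy q)

0ℝ 1ℝ : ℝ
0ℝ = fromℚ 0ℚ
1ℝ = fromℚ 1ℚ

-_ : ℝ → ℝ
- x = real (λ n → ℚ.- seq x n) (neg-cauchy (seq x) (cauchy x))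

_+_ _-_ _*_ : ℝ → ℝ → ℝ
x + y = real (λ n → seq x n ℚ.+ seq y n) (+-cauchy (seq x) (seq y) (cauchy x) (cauchy y))
x - y = x + (- y)
x * y = real (λ n → seq x n ℚ.* seq y n) (*-cauchy (seq x) (seq y) (cauchy x) (cauchy y))

_≈_ : Rel ℝ 0ℓ
x ≈ y = ∀ ε → 0ℚ ℚ.< ε →
  ∃[ N ] (∀ n → N ℕ.≤ n → ℚ.∣ seq x n ℚ.- seq y n ∣ ℚ.< ε)

-- A uniform gap is needed: pointwise strict inequality is lost in the limit.
_<_ : Rel ℝ 0ℓ
x < y = ∃[ ε ] (0ℚ ℚ.< ε) × ∃[ N ] (∀ n → N ℕ.≤ n → seq x n ℚ.+ ε ℚ.< seq y n)

_≤_ : Rel ℝ 0ℓ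
x ≤ y = ¬ (y < x)

-- Apartness, the positive form of x ≠ y.
_#_ : Rel ℝ 0ℓ
x # y = x < y ⊎ y < x

ℝ^_ : ℕ → Set
ℝ^ m = Vector ℝ m

∑ : ∀ {m} → Vector ℝ m → ℝ
∑ = foldr _+_ 0ℝ

infixl 7 _·_

_·_ : ∀ {m} → ℝ^ m → ℝ^ m → ℝ
a · x = ∑ (λ i → a i * x i)

dist² : ∀ {m} → ℝ^ m → ℝ^ m → ℝ
dist² x y = ∑ (λ i → (x i - y i) * (x i - y i))

PointSet : ℕ → Set₁
PointSet m = ℝ^ m → Set

Extensional : ∀ {m} → PointSet m → Set
Extensional K = ∀ {x y} → (∀ i → x i ≈ y i) → K x → K y

Convex : ∀ {m} → PointSet m → Set
Convex K = ∀ {x y} → K x → K y → ∀ t → 0ℝ ≤ t → t ≤ 1ℝ →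
  K (λ i → (1ℝ - t) * x i + t * y i)

AffineHull : ∀ {m} → PointSet m → PointSet m
AffineHull {m} K y =
  ∃[ k ] Σ[ p ∈ (Fin k → ℝ^ m) ] Σ[ w ∈ Vector ℝ k ]
    (∀ j → K (p j)) × (∑ w ≈ 1ℝ) × (∀ i → y i ≈ ∑ (λ j → w j * p j i))

RelativelyOpen : ∀ {m} → PointSet m → Set
RelativelyOpen K = ∀ {x} → K x →
  ∃[ ε ] (0ℝ < ε) × (∀ {y} → AffineHull K y → dist² y x < ε * ε → K y)

record Hyperplane (m : ℕ) : Set where
  field
    normal   : ℝ^ m
    offset   : ℝ
    normal≠0 : ∃[ i ] (normal i # 0ℝ)

  _⁺ _⁻ : PointSet m
  _⁺ x = offset < normal · x
  _⁻ x = normal · x < offset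

open Hyperplane public using (_⁺; _⁻)

module _ {V : Set} (_~_ : Rel V 0ℓ) where

  Connected : Set
  Connected = ∀ u v → Star _~_ u v

  record Cycle : Set where
    field
      {k}      : ℕ
      vertex   : Fin (3 ℕ.+ k) → V
      distinct : Injective _≡_ _≡_ vertex
      step     : ∀ i → vertex (inject₁ i) ~ vertex (suc i)
      close    : vertex (fromℕ (2 ℕ.+ k)) ~ vertex zero

  Acyclic : Set
  Acyclic = ¬ Cycle

-- The ground set U is Fin n; a family C ⊆ 2^U is its characteristic function,
-- so that membership is decidable and proof-irrelevant.
SetFamily : ℕ → Set
SetFamily n = Subset n → Bool

infix 4 _∈ᶠ_

_∈ᶠ_ : ∀ {n} → Subset n → SetFamily n → Set
X ∈ᶠ C = T (C X)

_△_ : ∀ {n} → Subset n → Subset n → Subset n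
X △ Y = (X ─ Y) ∪ (Y ─ X)

module OneInclusion {n} (C : SetFamily n) where

  Vertex : Set
  Vertex = ∃[ X ] X ∈ᶠ C

  Adjacent : Rel Vertex 0ℓ
  Adjacent (X , _) (Y , _) = ∣ X △ Y ∣ ≡ 1

record IsMedian {n} (C : SetFamily n) : Set where
  field
    C1′ : ∅ ∈ᶠ C
    C2  : ∀ X Y → X ∈ᶠ C → Y ∈ᶠ C → X ∩ Y ∈ᶠ C
    C6  : ∀ x y → x ≢ y → ∃[ K ] (K ∈ᶠ C) × (∣ (⁅ x ⁆ ∪ ⁅ y ⁆) ∩ K ∣ ≡ 1)
    C7  : (K M : Fin 3 → Subset n) →
          (∀ i → K i ∈ᶠ C) → (∀ i → M i ∈ᶠ C) →
          (∀ i j k → i ≢ j → j ≢ k → i ≢ k → K i ∪ K j ⊆ M k) →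
          K 0F ∪ K 1F ∪ K 2F ∈ᶠ C

record IsTree {n} (C : SetFamily n) : Set where
  open OneInclusion C
  field
    isMedian  : IsMedian C
    connected : Connected Adjacent
    acyclic   : Acyclic Adjacent

record Realization {n} (C : SetFamily n) (m : ℕ) : Set₁ where
  field
    H              : Fin n → Hyperplane m
    K              : PointSet m
    extensional    : Extensional K
    convex         : Convex K
    relativelyOpen : RelativelyOpen K
    realizes       : ∀ X → X ∈ᶠ C ⇔
      (∃[ x ] K x × (∀ e → e ∈ X → (H e ⁺) x) × (∀ e → e ∉ X → (H e ⁻) x))

IsEuclideanDimension : ∀ {n} → SetFamily n → ℕ → Set₁
IsEuclideanDimension C m =
  Realization C m × (∀ k → Realization C k → m ℕ.≤ k)

{-# OPTIONS --safe #-}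
module Submission where

-- Closure under ∩, C7 and the absence of 4-cycles make T a rooted forest: every
-- element e labels at most one edge of T, and the smallest member X ∋ e is the path
-- from the root ∅ to the far end of that edge.  Nested intervals of integers
-- are assigned to the members of T, disjoint ones to siblings.  In the convex set
-- K = { y > x² } the cap cut off by the chord over [a, b] consists of the points with
-- y − x² < (x − a)(b − x), so caps are nested or disjoint like their intervals, and the
-- cells of this arrangement are exactly the vertices of T.

open import Defs
open import Data.Bool.Base using (Bool; true; false; not; _∧_)
import Data.Bool.Properties as Bool
open import Data.Empty using (⊥-elim)
open import Data.Fin.Base as Fin using (Fin; zero; suc; toℕ)
open import Data.Fin.Patterns using (0F; 1F; 2F; 3F)
import Data.Fin.Properties as Fin
open import Data.Fin.Subset
  using (Subset; inside; outside; _∈_; _∉_; _⊆_; _⊂_; _∩_; _∪_; ∁; ∣_∣) renaming (⊥ to ∅)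
open import Data.Fin.Subset.Induction using (⊂-wellFounded)
open import Data.Fin.Subset.Properties
  using ( _∈?_; _⊆?_; anySubset?; ⊆-antisym; ⊆-refl; ∉⊥; ⊥⊆; ∪-identityʳ
        ; x∈p∩q⁺; x∈p∩q⁻; x∈p∪q⁺; x∈p∪q⁻; p∩q⊆p; p∩q⊆q)
open import Data.Nat.Base as ℕ using (ℕ; zero; suc)
import Data.Nat.Properties as ℕ
open import Data.Product using (∃; ∃-syntax; _×_; _,_; proj₁; proj₂)
open import Data.Rational.Base as ℚ using (ℚ; 0ℚ; 1ℚ; ½)
import Data.Rational.Properties as ℚ
open import Data.Rational.Solver using (module +-*-Solver)
open import Data.Sum.Base using (_⊎_; inj₁; inj₂; [_,_]′)
open import Data.Vec.Base using (_∷_; []; lookup; updateAt; here; there)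
open import Data.Vec.Functional using () renaming ([] to []ᶠ; _∷_ to _∷ᶠ_)
open import Data.Vec.Properties
  using ([]=⇒lookup; updateAt-minimal; lookup∘updateAt; lookup∘updateAt′)
open import Function.Base using (_∘_; id; case_of_)
open import Function.Bundles using (mk⇔)
open import Induction.WellFounded using (Acc; acc)
open import Relation.Binary.Construct.Closure.ReflexiveTransitive using (Star; _◅_) renaming (ε to nil)
open import Relation.Binary.Definitions using (tri<; tri≈; tri>)
open import Relation.Binary.PropositionalEquality
  using (_≡_; _≢_; refl; sym; trans; cong; cong₂; subst; subst₂; ≢-sym; module ≡-Reasoning)
open import Relation.Nullary using (¬_; Dec; yes; no; contradiction)
open import Relation.Nullary.Decidable using (_×-dec_; map′)
open +-*-Solver using (solve; _:=_; _:+_; _:*_; _:-_; :-_; con)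

-- For a member `Y`, `e ∈ Y` holds exactly when the top of `e` lies below `Y`, so membership is
-- ancestry in the tree. The harder direction is to show that the sign pattern `S` of an arbitrary
-- point of `K` is a member. Two facts about caps suffice: disjoint intervals have disjoint caps,
-- and the cap of an interval contains those of its subintervals. The first makes the tops of the
-- elements of `S` a chain, the second closes `S` under passing to ancestors; so `S` is the largest
-- top in that chain, or `∅`. The order of the reals is undecidable, but a strict inequality of
-- reals holds termwise from some index on. Finitely many of them are tested at one common index,
-- and the cap arguments take place in ℚ.

private
  variable
    n : ℕ

-- Subsets and the 1-inclusion graph

flip : Subset n → Fin n → Subset n
flip X e = updateAt X e not

flip-∈ : ∀ {X : Subset n} {e} → e ∉ X → e ∈ flip X e
flip-∈ {X = outside ∷ X} {zero}  e∉X = here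
flip-∈ {X = inside ∷ X}  {zero}  e∉X = contradiction here e∉X
flip-∈ {X = _ ∷ X}       {suc e} e∉X = there (flip-∈ (e∉X ∘ there))

flip-∉ : ∀ {X : Subset n} {e} → e ∈ X → e ∉ flip X e
flip-∉ (there e∈X) (there e∈flip) = flip-∉ e∈X e∈flip

flip-≢⁺ : ∀ {X : Subset n} {e f} → f ≢ e → f ∈ X → f ∈ flip X e
flip-≢⁺ f≢e = updateAt-minimal _ _ _ f≢e

flip-involutive : ∀ (X : Subset n) e → flip (flip X e) e ≡ X
flip-involutive (x ∷ X) zero    = cong (_∷ X) (Bool.not-involutive x)
flip-involutive (x ∷ X) (suc e) = cong (x ∷_) (flip-involutive X e)

flip-≢⁻ : ∀ {X : Subset n} {e f} → f ≢ e → f ∈ flip X e → f ∈ X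
flip-≢⁻ {X = X} {e} f≢e f∈ = subst (_ ∈_) (flip-involutive X e) (flip-≢⁺ f≢e f∈)

flip-comm : ∀ (X : Subset n) e f → flip (flip X e) f ≡ flip (flip X f) e
flip-comm (x ∷ X) zero    zero    = refl
flip-comm (x ∷ X) zero    (suc f) = refl
flip-comm (x ∷ X) (suc e) zero    = refl
flip-comm (x ∷ X) (suc e) (suc f) = cong (x ∷_) (flip-comm X e f)

flip-⊆ : ∀ {X : Subset n} {e} → e ∈ X → flip X e ⊆ X
flip-⊆ {e = e} e∈X {f} f∈ with f Fin.≟ e
... | yes refl = e∈X
... | no  f≢e  = flip-≢⁻ f≢e f∈

⊆-flip : ∀ {X : Subset n} {e} → e ∉ X → X ⊆ flip X e
⊆-flip e∉X f∈X = flip-≢⁺ (λ where refl → e∉X f∈X) f∈X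

⊆⇒⊆-flip : ∀ {X Y : Subset n} {e} → Y ⊆ X → e ∉ Y → Y ⊆ flip X e
⊆⇒⊆-flip Y⊆X e∉Y f∈Y = flip-≢⁺ (λ where refl → e∉Y f∈Y) (Y⊆X f∈Y)

⊆⇒flip-⊆ : ∀ {X Y : Subset n} {e} → Y ⊆ X → e ∈ X → flip Y e ⊆ X
⊆⇒flip-⊆ {e = e} Y⊆X e∈X {f} f∈ with f Fin.≟ e
... | yes refl = e∈X
... | no  f≢e  = Y⊆X (flip-≢⁻ f≢e f∈)

∩-flip : ∀ {X : Subset n} {e} → e ∈ X → X ∩ flip X e ≡ flip X e
∩-flip {X = X} {e} e∈X = ⊆-antisym (p∩q⊆q X _) λ f∈ → x∈p∩q⁺ (flip-⊆ e∈X f∈ , f∈)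

flip-∩-flip : ∀ {X : Subset n} {e f} → e ∈ X → f ∈ X → e ≢ f →
  flip X e ∩ flip X f ≡ flip (flip X e) f
flip-∩-flip {X = X} {e} {f} e∈X f∈X e≢f = ⊆-antisym to from
  where
  to : flip X e ∩ flip X f ⊆ flip (flip X e) f
  to g∈ = let g∈e , g∈f = x∈p∩q⁻ (flip X e) _ g∈ in
    flip-≢⁺ (λ where refl → flip-∉ f∈X g∈f) g∈e
  from : flip (flip X e) f ⊆ flip X e ∩ flip X f
  from g∈ = x∈p∩q⁺
    ( flip-⊆ (flip-≢⁺ (≢-sym e≢f) f∈X) g∈
    , flip-⊆ (flip-≢⁺ e≢f e∈X) (subst (_ ∈_) (flip-comm X e f) g∈))

∣△∣≡0⇒≡ : ∀ (X Y : Subset n) → ∣ X △ Y ∣ ≡ 0 → X ≡ Y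
∣△∣≡0⇒≡ []            []            _  = refl
∣△∣≡0⇒≡ (inside ∷ X)  (inside ∷ Y)  eq = cong (inside ∷_) (∣△∣≡0⇒≡ X Y eq)
∣△∣≡0⇒≡ (outside ∷ X) (outside ∷ Y) eq = cong (outside ∷_) (∣△∣≡0⇒≡ X Y eq)

∣△∣≡1⇒flip : ∀ (X Y : Subset n) → ∣ X △ Y ∣ ≡ 1 → ∃[ e ] Y ≡ flip X e
∣△∣≡1⇒flip []            []            ()
∣△∣≡1⇒flip (inside ∷ X)  (outside ∷ Y) eq =
  zero , cong (outside ∷_) (sym (∣△∣≡0⇒≡ X Y (ℕ.suc-injective eq)))
∣△∣≡1⇒flip (outside ∷ X) (inside ∷ Y)  eq =
  zero , cong (inside ∷_) (sym (∣△∣≡0⇒≡ X Y (ℕ.suc-injective eq)))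
∣△∣≡1⇒flip (inside ∷ X)  (inside ∷ Y)  eq =
  let e , Y≡ = ∣△∣≡1⇒flip X Y eq in suc e , cong (inside ∷_) Y≡
∣△∣≡1⇒flip (outside ∷ X) (outside ∷ Y) eq =
  let e , Y≡ = ∣△∣≡1⇒flip X Y eq in suc e , cong (outside ∷_) Y≡

∣X△X∣≡0 : ∀ (X : Subset n) → ∣ X △ X ∣ ≡ 0
∣X△X∣≡0 []            = refl
∣X△X∣≡0 (inside ∷ X)  = ∣X△X∣≡0 X
∣X△X∣≡0 (outside ∷ X) = ∣X△X∣≡0 X

∣X△flip∣≡1 : ∀ (X : Subset n) e → ∣ X △ flip X e ∣ ≡ 1
∣X△flip∣≡1 (inside ∷ X)  zero    = cong ℕ.suc (∣X△X∣≡0 X)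
∣X△flip∣≡1 (outside ∷ X) zero    = cong ℕ.suc (∣X△X∣≡0 X)
∣X△flip∣≡1 (inside ∷ X)  (suc e) = ∣X△flip∣≡1 X e
∣X△flip∣≡1 (outside ∷ X) (suc e) = ∣X△flip∣≡1 X e

-- A retraction onto the interval [Y, X], mapping edges to edges or to single vertices.
project : Subset n → Subset n → Subset n → Subset n
project X Y W = (W ∩ X) ∪ Y

project-flip : ∀ {X Y : Subset n} {e} W → e ∈ X → e ∉ Y →
  project X Y (flip W e) ≡ flip (project X Y W) e
project-flip {Y = inside ∷ Y}  (w ∷ W)       here        e∉Y = contradiction here e∉Y
project-flip {Y = outside ∷ Y} (inside ∷ W)  here        e∉Y = refl
project-flip {Y = outside ∷ Y} (outside ∷ W) here        e∉Y = refl
project-flip {Y = y ∷ Y}       (w ∷ W)       (there e∈X) e∉Y =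
  cong (_ ∷_) (project-flip W e∈X (e∉Y ∘ there))

project-flip-∉ : ∀ {X Y : Subset n} {e} W → e ∉ X → project X Y (flip W e) ≡ project X Y W
project-flip-∉ {X = inside ∷ X}  {y ∷ Y} {zero}  (w ∷ W) e∉X = contradiction here e∉X
project-flip-∉ {X = outside ∷ X} {y ∷ Y} {zero}  (w ∷ W) e∉X
  rewrite Bool.∧-zeroʳ w | Bool.∧-zeroʳ (not w) = refl
project-flip-∉ {X = x ∷ X}       {y ∷ Y} {suc e} (w ∷ W) e∉X =
  cong (_ ∷_) (project-flip-∉ W (e∉X ∘ there))

project-flip-∈ : ∀ {X Y : Subset n} {e} W → e ∈ Y → project X Y (flip W e) ≡ project X Y W
project-flip-∈ {X = x ∷ X} {_ ∷ Y} (w ∷ W) here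
  rewrite Bool.∨-zeroʳ (not w ∧ x) | Bool.∨-zeroʳ (w ∧ x) = refl
project-flip-∈ {X = x ∷ X} {y ∷ Y} (w ∷ W) (there e∈Y) = cong (_ ∷_) (project-flip-∈ W e∈Y)

project-upper : ∀ {X Y : Subset n} → Y ⊆ X → project X Y X ≡ X
project-upper {X = X} {Y} Y⊆X = ⊆-antisym
  (λ f∈ → [ p∩q⊆p X X , Y⊆X ]′ (x∈p∪q⁻ (X ∩ X) Y f∈))
  (λ f∈ → x∈p∪q⁺ (inj₁ (x∈p∩q⁺ (f∈ , f∈))))

project-lower : ∀ (X Y : Subset n) → project X Y Y ≡ Y
project-lower X Y = ⊆-antisym
  (λ f∈ → [ p∩q⊆p Y X , id ]′ (x∈p∪q⁻ (Y ∩ X) Y f∈))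
  (λ f∈ → x∈p∪q⁺ (inj₂ f∈))

-- The rooted tree formed by the members

module Tree {n : ℕ} (C : SetFamily n) (isTree : IsTree C) where

  open OneInclusion C
  open IsTree isTree
  open IsMedian isMedian

  -- C7 with K₃ = ∅.
  ∪-closed : ∀ {X A B} → X ∈ᶠ C → A ∈ᶠ C → B ∈ᶠ C → A ⊆ X → B ⊆ X → A ∪ B ∈ᶠ C
  ∪-closed {X} {A} {B} X∈C A∈C B∈C A⊆X B⊆X =
    subst (_∈ᶠ C) (cong (A ∪_) (∪-identityʳ B))
      (C7 K (λ _ → X) K∈C (λ _ → X∈C) (λ i j _ _ _ _ f∈ → [ K⊆X i , K⊆X j ]′ (x∈p∪q⁻ (K i) (K j) f∈)))
    where
    K : Fin 3 → Subset n
    K 0F = A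
    K 1F = B
    K 2F = ∅
    K∈C : ∀ i → K i ∈ᶠ C
    K∈C 0F = A∈C
    K∈C 1F = B∈C
    K∈C 2F = C1′
    K⊆X : ∀ i → K i ⊆ X
    K⊆X 0F = A⊆X
    K⊆X 1F = B⊆X
    K⊆X 2F = ⊥-elim ∘ ∉⊥

  -- `∪-closed` needs a common upper bound; both pieces of the projection lie below `X`.
  project-∈ : ∀ {X Y W} → X ∈ᶠ C → Y ∈ᶠ C → Y ⊆ X → W ∈ᶠ C → project X Y W ∈ᶠ C
  project-∈ {X} {Y} {W} X∈C Y∈C Y⊆X W∈C =
    ∪-closed X∈C (C2 W X W∈C X∈C) Y∈C (p∩q⊆q W X) Y⊆X

  -- Turns connectedness of the whole graph into an edge inside the interval `[Y, X]`: a path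
  -- projects to a walk that moves or rests at each step, and its first real move has a label in `X`
  -- but not in `Y`.
  first-move : ∀ {X Y} → X ∈ᶠ C → Y ∈ᶠ C → Y ⊆ X → ∀ {U V} → Star Adjacent U V →
    project X Y (proj₁ U) ≢ project X Y (proj₁ V) →
    ∃[ e ] e ∈ X × e ∉ Y × flip (project X Y (proj₁ U)) e ∈ᶠ C
  first-move X∈C Y∈C Y⊆X nil ≢ = contradiction refl ≢
  first-move {X} {Y} X∈C Y∈C Y⊆X {U , _} {V} (_◅_ {j = W , W∈C} adj path) ≢
    with ∣△∣≡1⇒flip U W adj
  ... | e , refl with e ∈? X | e ∈? Y
  ... | yes e∈X | no  e∉Y = e , e∈X , e∉Y ,
    subst (_∈ᶠ C) (project-flip U e∈X e∉Y) (project-∈ X∈C Y∈C Y⊆X W∈C)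
  -- A resting step: replacing the projection of `U` by the equal projection of its neighbour
  -- carries hypothesis and goal along.
  ... | no e∉X | _ rewrite sym (project-flip-∉ {Y = Y} U e∉X) = first-move X∈C Y∈C Y⊆X path ≢
  ... | yes _ | yes e∈Y rewrite sym (project-flip-∈ {X = X} U e∈Y) = first-move X∈C Y∈C Y⊆X path ≢

  -- The projection fixes both ends of the interval, so a path from `X` to `Y` must at some point
  -- leave `X` downwards. `ascend` reads a path from `Y` to `X` instead.
  descend : ∀ {X Y} → X ∈ᶠ C → Y ∈ᶠ C → Y ⊆ X → Y ≢ X →
    ∃[ e ] e ∈ X × e ∉ Y × flip X e ∈ᶠ C
  descend {X} {Y} X∈C Y∈C Y⊆X Y≢X with
    first-move X∈C Y∈C Y⊆X (connected (X , X∈C) (Y , Y∈C))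
      (λ eq → Y≢X (trans (sym (project-lower X Y)) (trans (sym eq) (project-upper Y⊆X))))
  ... | move rewrite project-upper Y⊆X = move

  ascend : ∀ {X Y} → X ∈ᶠ C → Y ∈ᶠ C → Y ⊆ X → Y ≢ X →
    ∃[ e ] e ∈ X × e ∉ Y × flip Y e ∈ᶠ C
  ascend {X} {Y} X∈C Y∈C Y⊆X Y≢X with
    first-move X∈C Y∈C Y⊆X (connected (Y , Y∈C) (X , X∈C))
      (λ eq → Y≢X (trans (sym (project-lower X Y)) (trans eq (project-upper Y⊆X))))
  ... | move rewrite project-lower X Y = move

  -- X is the path from the root to the far end of the edge labelled e.
  record IsTop (X : Subset n) (e : Fin n) : Set where
    constructor isTop
    field
      member      : X ∈ᶠ C
      top∈        : e ∈ X
      flip-member : flip X e ∈ᶠ C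

  open IsTop

  -- Two downward edges at `X` with different labels span a 4-cycle, its lowest corner being a
  -- member by `C2`.
  top-unique : ∀ {X e f} → IsTop X e → IsTop X f → e ≡ f
  top-unique {X} {e} {f} top-e top-f with e Fin.≟ f
  ... | yes e≡f = e≡f
  ... | no  e≢f = contradiction square acyclic
    where
    vertex : Fin 4 → Vertex
    vertex 0F = X , member top-e
    vertex 1F = flip X e , flip-member top-e
    vertex 2F = flip (flip X e) f
      , subst (_∈ᶠ C) (flip-∩-flip (top∈ top-e) (top∈ top-f) e≢f)
          (C2 _ _ (flip-member top-e) (flip-member top-f))
    vertex 3F = flip X f , flip-member top-f

    -- The bits at `e` and `f` tell the four corners apart: `code` inverts `vertex`, whence
    -- distinctness.
    code : Bool → Bool → Fin 4
    code true  true  = 0F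
    code false true  = 1F
    code false false = 2F
    code true  false = 3F

    X[e] : lookup X e ≡ true
    X[e] = []=⇒lookup (top∈ top-e)
    X[f] : lookup X f ≡ true
    X[f] = []=⇒lookup (top∈ top-f)
    flipped : ∀ Y g → lookup (flip Y g) g ≡ not (lookup Y g)
    flipped Y g = lookup∘updateAt g Y
    kept : ∀ Y {g h} → g ≢ h → lookup (flip Y h) g ≡ lookup Y g
    kept Y g≢h = lookup∘updateAt′ _ _ g≢h Y

    decode : ∀ i → code (lookup (proj₁ (vertex i)) e) (lookup (proj₁ (vertex i)) f) ≡ i
    decode 0F rewrite X[e] | X[f] = refl
    decode 1F rewrite flipped X e | kept X (≢-sym e≢f) | X[e] | X[f] = refl
    decode 2F rewrite kept (flip X e) e≢f | flipped (flip X e) f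
      | flipped X e | kept X (≢-sym e≢f) | X[e] | X[f] = refl
    decode 3F rewrite kept X e≢f | flipped X f | X[e] | X[f] = refl

    square : Cycle Adjacent
    square = record
      { vertex   = vertex
      ; distinct = λ {i} {j} eq → trans (sym (decode i))
          (trans (cong (λ v → code (lookup (proj₁ v) e) (lookup (proj₁ v) f)) eq) (decode j))
      ; step     = λ where
          0F → ∣X△flip∣≡1 X e
          1F → ∣X△flip∣≡1 (flip X e) f
          2F → subst (λ Y → ∣ flip (flip X e) f △ Y ∣ ≡ 1)
                 (trans (cong (λ Y → flip Y e) (flip-comm X e f)) (flip-involutive (flip X f) e))
                 (∣X△flip∣≡1 (flip (flip X e) f) e)
      ; close    = subst (λ Y → ∣ flip X f △ Y ∣ ≡ 1) (flip-involutive X f) (∣X△flip∣≡1 (flip X f) f)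
      }

  -- If `X ∩ Y` were smaller than `X`, `descend` would remove from `X` an element outside `Y`; but
  -- the only removable element of `X` is `e`, which lies in `Y`.
  top-minimal : ∀ {X Y e} → IsTop X e → Y ∈ᶠ C → e ∈ Y → X ⊆ Y
  top-minimal {X} {Y} {e} top Y∈C e∈Y {g} g∈X with g ∈? Y
  ... | yes g∈Y = g∈Y
  ... | no  g∉Y =
    let X∩Y∈C = C2 X Y (member top) Y∈C
        f , f∈X , f∉X∩Y , flip∈C′ = descend (member top) X∩Y∈C (p∩q⊆p X Y)
          (λ eq → g∉Y (p∩q⊆q X Y (subst (g ∈_) (sym eq) g∈X)))
        e≡f = top-unique top (isTop (member top) f∈X flip∈C′)
    in contradiction (x∈p∩q⁺ (top∈ top , e∈Y)) (subst (_∉ X ∩ Y) (sym e≡f) f∉X∩Y)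

  down-unique : ∀ {X Y e} → IsTop X e → IsTop Y e → X ≡ Y
  down-unique top top′ =
    ⊆-antisym (top-minimal top (member top′) (top∈ top′)) (top-minimal top′ (member top) (top∈ top))

  -- A path can lose `e` only along an edge labelled `e`, and the end of that edge containing `e` is
  -- a top.
  crossing : ∀ {e} {U V} → Star Adjacent U V → e ∈ proj₁ U → e ∉ proj₁ V → ∃[ X ] IsTop X e
  crossing nil e∈U e∉V = contradiction e∈U e∉V
  crossing {e} {U , U∈C} (_◅_ {j = W , W∈C} adj path) e∈U e∉V with ∣△∣≡1⇒flip U W adj
  ... | f , refl with e Fin.≟ f
  ... | yes refl = U , isTop U∈C e∈U W∈C
  ... | no  e≢f  = crossing path (flip-≢⁺ e≢f e∈U) e∉V

  top-exists : ∀ {X e} → X ∈ᶠ C → e ∈ X → ∃[ Y ] IsTop Y e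
  top-exists {X} X∈C e∈X = crossing (connected (X , X∈C) (∅ , C1′)) e∈X ∉⊥

  isTop? : ∀ e X → Dec (IsTop X e)
  isTop? e X = map′ (λ (a , b , c) → isTop a b c) (λ t → member t , top∈ t , flip-member t)
    (Bool.T? (C X) ×-dec e ∈? X ×-dec Bool.T? (C (flip X e)))

  used? : ∀ e → Dec (∃[ X ] IsTop X e)
  used? e = anySubset? (isTop? e)

-- Intervals

totalWeight : (Fin n → ℕ) → Subset n → ℕ
totalWeight w []            = 0
totalWeight w (inside ∷ X)  = w zero ℕ.+ totalWeight (w ∘ suc) X
totalWeight w (outside ∷ X) = totalWeight (w ∘ suc) X

totalWeight-flip : ∀ (w : Fin n → ℕ) {X e} → e ∈ X →
  totalWeight w X ≡ totalWeight w (flip X e) ℕ.+ w e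
totalWeight-flip w {_ ∷ X} here = ℕ.+-comm (w zero) (totalWeight (w ∘ suc) X)
totalWeight-flip w {inside ∷ X} (there e∈X) =
  trans (cong (w zero ℕ.+_) (totalWeight-flip (w ∘ suc) e∈X)) (sym (ℕ.+-assoc (w zero) _ _))
totalWeight-flip w {outside ∷ X} (there e∈X) = totalWeight-flip (w ∘ suc) e∈X

∣∁-flip∣ : ∀ {X : Subset n} {e} → e ∈ X → ∣ ∁ (flip X e) ∣ ≡ suc ∣ ∁ X ∣
∣∁-flip∣ {X = _ ∷ X}       here        = refl
∣∁-flip∣ {X = inside ∷ X}  (there e∈X) = ∣∁-flip∣ e∈X
∣∁-flip∣ {X = outside ∷ X} (there e∈X) = cong suc (∣∁-flip∣ e∈X)

module Intervals {n : ℕ} (C : SetFamily n) (isTree : IsTree C) where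

  open Tree C isTree
  open IsTop
  open IsTree isTree using (isMedian)
  open IsMedian isMedian using (C1′; C2)

  -- The base 2 + n leaves room, in the interval of a vertex, for the site of that vertex
  -- followed by one slot for each possible child.
  width : Subset n → ℕ
  width X = (2 ℕ.+ n) ℕ.^ suc ∣ ∁ X ∣

  -- How far a child's interval starts past the start of its parent's: slot `suc (toℕ e)`, slot zero
  -- being kept for the parent's site.
  weight : Fin n → ℕ
  weight e with used? e
  ... | yes (X , _) = suc (toℕ e) ℕ.* width X
  ... | no  _       = 0

  -- The elements of a member label its path from the root, so a plain sum over `X` accumulates the
  -- shifts of all ancestors without recursion along the tree.
  lower upper site : Subset n → ℕ
  lower X = totalWeight weight X
  upper X = lower X ℕ.+ width X
  site  X = suc (lower X)

  -- C6 permits one element that labels no edge; it gets the degenerate interval [0, 0],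
  -- whose chord is a tangent of the parabola.
  left right : Fin n → ℕ
  left e with used? e
  ... | yes (X , _) = lower X
  ... | no  _       = 0
  right e with used? e
  ... | yes (X , _) = upper X
  ... | no  _       = 0

  left≤right : ∀ e → left e ℕ.≤ right e
  left≤right e with used? e
  ... | yes (X , _) = ℕ.m≤m+n (lower X) (width X)
  ... | no  _       = ℕ.z≤n

  -- `used?` returns a top of its own choice; `down-unique` identifies it with `X`.
  weight-top : ∀ {X e} → IsTop X e → weight e ≡ suc (toℕ e) ℕ.* width X
  weight-top {X} {e} top with used? e
  ... | yes (Y , top′) rewrite down-unique top top′ = refl
  ... | no  unused     = contradiction (X , top) unused

  left-top : ∀ {X e} → IsTop X e → left e ≡ lower X
  left-top {X} {e} top with used? e
  ... | yes (Y , top′) rewrite down-unique top top′ = refl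
  ... | no  unused     = contradiction (X , top) unused

  right-top : ∀ {X e} → IsTop X e → right e ≡ upper X
  right-top {X} {e} top with used? e
  ... | yes (Y , top′) rewrite down-unique top top′ = refl
  ... | no  unused     = contradiction (X , top) unused

  1<width : ∀ X → 1 ℕ.< width X
  1<width X = ℕ.*-mono-≤ {2} {2 ℕ.+ n} {1} (ℕ.s≤s (ℕ.s≤s ℕ.z≤n)) (ℕ.m^n>0 (2 ℕ.+ n) ∣ ∁ X ∣)

  lower-child : ∀ {X e} → IsTop X e → lower X ≡ lower (flip X e) ℕ.+ suc (toℕ e) ℕ.* width X
  lower-child {X} {e} top =
    trans (totalWeight-flip weight (top∈ top)) (cong (lower (flip X e) ℕ.+_) (weight-top top))

  width-flip : ∀ {X e} → e ∈ X → width (flip X e) ≡ (2 ℕ.+ n) ℕ.* width X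
  width-flip e∈X = cong ((2 ℕ.+ n) ℕ.^_) (cong suc (∣∁-flip∣ e∈X))

  lower-child-≤ : ∀ {X e} → IsTop X e → lower (flip X e) ℕ.≤ lower X
  lower-child-≤ {X} {e} top = subst (lower (flip X e) ℕ.≤_) (sym (lower-child top)) (ℕ.m≤m+n _ _)

  upper-child : ∀ {X e} → IsTop X e → upper X ≡ lower (flip X e) ℕ.+ (2 ℕ.+ toℕ e) ℕ.* width X
  upper-child {X} {e} top = begin
    lower X ℕ.+ width X
      ≡⟨ cong (ℕ._+ width X) (lower-child top) ⟩
    lower (flip X e) ℕ.+ suc (toℕ e) ℕ.* width X ℕ.+ width X
      ≡⟨ ℕ.+-assoc (lower (flip X e)) _ _ ⟩
    lower (flip X e) ℕ.+ (suc (toℕ e) ℕ.* width X ℕ.+ width X)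
      ≡⟨ cong (lower (flip X e) ℕ.+_) (ℕ.+-comm _ (width X)) ⟩
    lower (flip X e) ℕ.+ (2 ℕ.+ toℕ e) ℕ.* width X ∎
    where open ≡-Reasoning

  upper-child-≤ : ∀ {X e} → IsTop X e → upper X ℕ.≤ upper (flip X e)
  upper-child-≤ {X} {e} top = begin
    upper X
      ≡⟨ upper-child top ⟩
    lower (flip X e) ℕ.+ (2 ℕ.+ toℕ e) ℕ.* width X
      ≤⟨ ℕ.+-monoʳ-≤ (lower (flip X e)) (ℕ.*-monoˡ-≤ (width X) (ℕ.s≤s (ℕ.s≤s (Fin.toℕ≤n e)))) ⟩
    lower (flip X e) ℕ.+ (2 ℕ.+ n) ℕ.* width X
      ≡⟨ cong (lower (flip X e) ℕ.+_) (width-flip (top∈ top)) ⟨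
    upper (flip X e) ∎
    where open ℕ.≤-Reasoning

  site-≤-child : ∀ {X e} → IsTop X e → site (flip X e) ℕ.≤ lower X
  site-≤-child {X} {e} top = begin
    suc (lower (flip X e))
      ≡⟨ ℕ.+-comm 1 _ ⟩
    lower (flip X e) ℕ.+ 1
      ≤⟨ ℕ.+-monoʳ-≤ (lower (flip X e)) (ℕ.<⇒≤ (1<width X)) ⟩
    lower (flip X e) ℕ.+ width X
      ≤⟨ ℕ.+-monoʳ-≤ (lower (flip X e)) (ℕ.m≤m+n (width X) _) ⟩
    lower (flip X e) ℕ.+ suc (toℕ e) ℕ.* width X
      ≡⟨ lower-child top ⟨
    lower X ∎
    where open ℕ.≤-Reasoning

  -- A common parent forces equal widths, so both intervals are slots of one grid, in the order of
  -- their labels.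
  sibling-< : ∀ {X Y e f} → IsTop X e → IsTop Y f → flip X e ≡ flip Y f → e Fin.< f →
    upper X ℕ.≤ lower Y
  sibling-< {X} {Y} {e} {f} top-e top-f Z≡ e<f = begin
    upper X
      ≡⟨ upper-child top-e ⟩
    lower (flip X e) ℕ.+ (2 ℕ.+ toℕ e) ℕ.* width X
      ≤⟨ ℕ.+-monoʳ-≤ (lower (flip X e)) (ℕ.*-monoˡ-≤ (width X) (ℕ.s≤s e<f)) ⟩
    lower (flip X e) ℕ.+ suc (toℕ f) ℕ.* width X
      ≡⟨ cong₂ (λ Z w → lower Z ℕ.+ suc (toℕ f) ℕ.* w) Z≡ width≡ ⟩
    lower (flip Y f) ℕ.+ suc (toℕ f) ℕ.* width Y
      ≡⟨ lower-child top-f ⟨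
    lower Y ∎
    where
    open ℕ.≤-Reasoning
    width≡ : width X ≡ width Y
    width≡ = cong (λ k → (2 ℕ.+ n) ℕ.^ k)
      (trans (sym (∣∁-flip∣ (top∈ top-e))) (trans (cong (∣_∣ ∘ ∁) Z≡) (∣∁-flip∣ (top∈ top-f))))

  siblings : ∀ {X Y e f} → IsTop X e → IsTop Y f → flip X e ≡ flip Y f → e ≢ f →
    upper X ℕ.≤ lower Y ⊎ upper Y ℕ.≤ lower X
  siblings {e = e} {f} top-e top-f Z≡ e≢f with Fin.<-cmp e f
  ... | tri< e<f _   _   = inj₁ (sibling-< top-e top-f Z≡ e<f)
  ... | tri≈ _   e≡f _   = contradiction e≡f e≢f
  ... | tri> _   _   f<e = inj₂ (sibling-< top-f top-e (sym Z≡) f<e)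

  -- Walks from `Y` down to `X`; each removed label lies outside `X`, so the walk stays above `X`.
  nested : ∀ {X Y} → X ∈ᶠ C → Y ∈ᶠ C → X ⊆ Y → lower X ℕ.≤ lower Y × upper Y ℕ.≤ upper X
  nested {X} X∈C Y∈C X⊆Y = go Y∈C X⊆Y (⊂-wellFounded _)
    where
    go : ∀ {Y} → Y ∈ᶠ C → X ⊆ Y → Acc _⊂_ Y → lower X ℕ.≤ lower Y × upper Y ℕ.≤ upper X
    go {Y} Y∈C X⊆Y (acc smaller) with Y ⊆? X
    ... | yes Y⊆X rewrite ⊆-antisym X⊆Y Y⊆X = ℕ.≤-refl , ℕ.≤-refl
    ... | no  Y⊈X =
      let e , e∈Y , e∉X , flip∈C = descend Y∈C X∈C X⊆Y (λ where refl → Y⊈X ⊆-refl)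
          top     = isTop Y∈C e∈Y flip∈C
          l≤ , ≤u = go flip∈C (⊆⇒⊆-flip X⊆Y e∉X) (smaller (flip-⊆ e∈Y , e , e∈Y , flip-∉ e∈Y))
      in ℕ.≤-trans l≤ (lower-child-≤ top) , ℕ.≤-trans (upper-child-≤ top) ≤u

  child-towards : ∀ {X Y} → X ∈ᶠ C → Y ∈ᶠ C → X ⊆ Y → X ≢ Y →
    ∃[ e ] e ∈ Y × e ∉ X × IsTop (flip X e) e
  child-towards {X} X∈C Y∈C X⊆Y X≢Y =
    let e , e∈Y , e∉X , flip∈C = ascend Y∈C X∈C X⊆Y X≢Y
    in e , e∈Y , e∉X , isTop flip∈C (flip-∈ e∉X) (subst (_∈ᶠ C) (sym (flip-involutive X e)) X∈C)

  -- `X ∩ Y` is the last common ancestor. The next vertices towards `X` and `Y` are distinct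
  -- children of it, since a shared label would already lie in the intersection.
  diverge : ∀ {X Y} → X ∈ᶠ C → Y ∈ᶠ C → ¬ X ⊆ Y → ¬ Y ⊆ X →
    ∃[ e ] ∃[ f ] ∃[ X′ ] ∃[ Y′ ] IsTop X′ e × IsTop Y′ f × X′ ⊆ X × Y′ ⊆ Y ×
      (upper X′ ℕ.≤ lower Y′ ⊎ upper Y′ ℕ.≤ lower X′)
  diverge {X} {Y} X∈C Y∈C X⊈Y Y⊈X =
    let Z   = X ∩ Y
        Z∈C = C2 X Y X∈C Y∈C
        e , e∈X , e∉Z , top-e = child-towards Z∈C X∈C (p∩q⊆p X Y)
          (λ eq → X⊈Y (p∩q⊆q X Y ∘ subst (_ ∈_) (sym eq)))
        f , f∈Y , f∉Z , top-f = child-towards Z∈C Y∈C (p∩q⊆q X Y)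
          (λ eq → Y⊈X (p∩q⊆p X Y ∘ subst (_ ∈_) (sym eq)))
    in e , f , flip Z e , flip Z f , top-e , top-f
      , ⊆⇒flip-⊆ (p∩q⊆p X Y) e∈X , ⊆⇒flip-⊆ (p∩q⊆q X Y) f∈Y
      , siblings top-e top-f (trans (flip-involutive Z e) (sym (flip-involutive Z f)))
          (λ e≡f → e∉Z (x∈p∩q⁺ (e∈X , subst (_∈ Y) (sym e≡f) f∈Y)))

  site<upper : ∀ X → site X ℕ.< upper X
  site<upper X = subst (ℕ._≤ upper X) (ℕ.+-comm (lower X) 2) (ℕ.+-monoʳ-≤ (lower X) (1<width X))

  site-inside : ∀ {X e} → X ∈ᶠ C → e ∈ X → left e ℕ.< site X × site X ℕ.< right e
  site-inside {X} {e} X∈C e∈X =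
    let Y , top = top-exists X∈C e∈X
        l≤ , ≤u = nested (member top) X∈C (top-minimal top X∈C e∈X)
    in subst (ℕ._< site X) (sym (left-top top)) (ℕ.s≤s l≤)
     , subst (site X ℕ.<_) (sym (right-top top)) (ℕ.<-≤-trans (site<upper X) ≤u)

  -- Either `X` is a proper ancestor of `Y`, whose interval then lies in a child slot to the right
  -- of the site, or the two diverge and have disjoint intervals.
  site-outside-top : ∀ {X Y e} → X ∈ᶠ C → e ∉ X → IsTop Y e → site X ℕ.≤ lower Y ⊎ upper Y ℕ.≤ site X
  site-outside-top {X} {Y} {e} X∈C e∉X top with X ⊆? Y
  ... | yes X⊆Y =
    let f , f∈Y , f∉X , top-f = child-towards X∈C (member top) X⊆Y (λ where refl → e∉X (top∈ top))
        l≤ , _ = nested (member top-f) (member top) (⊆⇒flip-⊆ X⊆Y f∈Y)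
        site≤ = subst (λ Z → site Z ℕ.≤ lower (flip X f)) (flip-involutive X f) (site-≤-child top-f)
    in inj₁ (ℕ.≤-trans site≤ l≤)
  ... | no X⊈Y =
    let _ , _ , X′ , Y′ , top-X′ , top-Y′ , X′⊆X , Y′⊆Y , apart =
          diverge X∈C (member top) X⊈Y (λ Y⊆X → e∉X (Y⊆X (top∈ top)))
        lX , uX = nested (member top-X′) X∈C X′⊆X
        lY , uY = nested (member top-Y′) (member top) Y′⊆Y
    in case apart of λ where
         (inj₁ X′≤Y′) → inj₁ (ℕ.≤-trans (ℕ.<⇒≤ (site<upper X)) (ℕ.≤-trans uX (ℕ.≤-trans X′≤Y′ lY)))
         (inj₂ Y′≤X′) → inj₂ (ℕ.≤-trans uY (ℕ.≤-trans Y′≤X′ (ℕ.≤-trans lX (ℕ.n≤1+n _))))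

  site-outside : ∀ {X e} → X ∈ᶠ C → e ∉ X → site X ℕ.≤ left e ⊎ right e ℕ.≤ site X
  site-outside {X} {e} X∈C e∉X with used? e
  ... | yes (Y , top) = site-outside-top X∈C e∉X top
  ... | no  _         = inj₂ ℕ.z≤n

  -- The hypotheses are what the geometry reveals about a sign pattern: no two caps containing the
  -- point are disjoint, and no cap containing it sits inside one that misses it.
  module _ (S : Subset n)
           (overlapping : ∀ {e f} → e ∈ S → f ∈ S → ¬ right e ℕ.≤ left f)
           (upward : ∀ {e f} → e ∈ S → f ∉ S → ¬ (left f ℕ.≤ left e × right e ℕ.≤ right f))
    where

    used : ∀ {e} → e ∈ S → ∃[ X ] IsTop X e
    -- With both labels equal to `e`, `overlapping` says that the interval is not degenerate, which
    -- excludes an element labelling no edge.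
    used {e} e∈S with overlapping e∈S e∈S
    ... | r≰l with used? e
    ... | yes top = top
    ... | no  _   = contradiction ℕ.z≤n r≰l

    -- The top of each `f ∈ X` is an ancestor of `X`, so its interval contains that of `e` and
    -- `upward` puts `f` into `S`.
    down-⊆ : ∀ {X e} → IsTop X e → e ∈ S → X ⊆ S
    down-⊆ {X} {e} top e∈S {f} f∈X with f ∈? S
    ... | yes f∈S = f∈S
    ... | no  f∉S =
      let Y , top-f = top-exists (member top) f∈X
          l≤ , ≤u   = nested (member top-f) (member top) (top-minimal top-f (member top) f∈X)
      in contradiction
           ( subst (ℕ._≤ left e) (sym (left-top top-f)) (subst (_ ℕ.≤_) (sym (left-top top)) l≤)
           , subst (ℕ._≤ right f) (sym (right-top top)) (subst (_ ℕ.≤_) (sym (right-top top-f)) ≤u))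
           (upward e∈S f∉S)

    comparable : ∀ {X Y} → X ∈ᶠ C → Y ∈ᶠ C → X ⊆ S → Y ⊆ S → ¬ Y ⊆ X → X ⊆ Y
    comparable {X} {Y} X∈C Y∈C X⊆S Y⊆S Y⊈X with X ⊆? Y
    ... | yes X⊆Y = X⊆Y
    ... | no  X⊈Y =
      let e , f , _ , _ , top-e , top-f , X′⊆X , Y′⊆Y , apart = diverge X∈C Y∈C X⊈Y Y⊈X
          e∈S = X⊆S (X′⊆X (top∈ top-e))
          f∈S = Y⊆S (Y′⊆Y (top∈ top-f))
      in case apart of λ where
           (inj₁ r≤l) → contradiction
             (subst (ℕ._≤ left f) (sym (right-top top-e)) (subst (_ ℕ.≤_) (sym (left-top top-f)) r≤l))
             (overlapping e∈S f∈S)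
           (inj₂ r≤l) → contradiction
             (subst (ℕ._≤ left e) (sym (right-top top-f)) (subst (_ ℕ.≤_) (sym (left-top top-e)) r≤l))
             (overlapping f∈S e∈S)

    -- Members inside `S` are pairwise comparable, so the top of an element not yet covered contains
    -- everything collected so far and can replace it.
    cover : ∀ k (g : Fin k → Fin n) →
      ∃[ X ] X ∈ᶠ C × X ⊆ S × (∀ i → g i ∈ S → g i ∈ X)
    cover zero    g = ∅ , C1′ , ⊥⊆ , λ ()
    cover (suc k) g with cover k (g ∘ suc)
    ... | X , X∈C , X⊆S , covers with g zero ∈? S | g zero ∈? X
    ... | no g₀∉S | _       = X , X∈C , X⊆S , λ where
      zero    g₀∈S → contradiction g₀∈S g₀∉S
      (suc i)      → covers i
    ... | yes _   | yes g₀∈X = X , X∈C , X⊆S , λ where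
      zero    _ → g₀∈X
      (suc i)   → covers i
    ... | yes g₀∈S | no g₀∉X =
      let Y , top = used g₀∈S
          X⊆Y     = comparable X∈C (member top) X⊆S (down-⊆ top g₀∈S) (λ Y⊆X → g₀∉X (Y⊆X (top∈ top)))
      in Y , member top , down-⊆ top g₀∈S , λ where
           zero    _   → top∈ top
           (suc i) g∈S → X⊆Y (covers i g∈S)

    laminar⇒member : S ∈ᶠ C
    laminar⇒member =
      let X , X∈C , X⊆S , covers = cover n id
      in subst (_∈ᶠ C) (⊆-antisym X⊆S (covers _)) X∈C

-- Rational estimates

infixl 6 _⊕_ _⊞_
infixl 7 _⊗_

-- With these operators a sign proof mirrors the shape of a polynomial, which the ring solver then
-- identifies with the desired difference.
_⊕_ : ∀ {p q} → 0ℚ ℚ.≤ p → 0ℚ ℚ.≤ q → 0ℚ ℚ.≤ p ℚ.+ q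
_⊕_ = ℚ.+-mono-≤

_⊞_ : ∀ {p q} → 0ℚ ℚ.< p → 0ℚ ℚ.≤ q → 0ℚ ℚ.< p ℚ.+ q
_⊞_ = ℚ.+-mono-<-≤

_⊗_ : ∀ {p q} → 0ℚ ℚ.≤ p → 0ℚ ℚ.≤ q → 0ℚ ℚ.≤ p ℚ.* q
_⊗_ {p} {q} 0≤p 0≤q = ℚ.nonNegative⁻¹ (p ℚ.* q)
  {{ℚ.nonNeg*nonNeg⇒nonNeg p {{ℚ.nonNegative 0≤p}} q {{ℚ.nonNegative 0≤q}}}}

*-positive : ∀ {p q} → 0ℚ ℚ.< p → 0ℚ ℚ.< q → 0ℚ ℚ.< p ℚ.* q
*-positive {p} {q} 0<p 0<q = ℚ.positive⁻¹ (p ℚ.* q)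
  {{ℚ.pos*pos⇒pos p {{ℚ.positive 0<p}} q {{ℚ.positive 0<q}}}}

p≤q⇒0≤q-p : ∀ {p q} → p ℚ.≤ q → 0ℚ ℚ.≤ q ℚ.- p
p≤q⇒0≤q-p {p} {q} p≤q = subst (ℚ._≤ q ℚ.- p) (ℚ.+-inverseʳ p) (ℚ.+-monoˡ-≤ (ℚ.- p) p≤q)

p<q⇒0<q-p : ∀ {p q} → p ℚ.< q → 0ℚ ℚ.< q ℚ.- p
p<q⇒0<q-p {p} {q} p<q = subst (ℚ._< q ℚ.- p) (ℚ.+-inverseʳ p) (ℚ.+-monoˡ-< (ℚ.- p) p<q)

private
  -+-cancel : ∀ p q → (q ℚ.- p) ℚ.+ p ≡ q
  -+-cancel = solve 2 (λ p q → (q :- p) :+ p := q) refl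

0≤q-p⇒p≤q : ∀ {p q} → 0ℚ ℚ.≤ q ℚ.- p → p ℚ.≤ q
0≤q-p⇒p≤q {p} {q} 0≤ = subst₂ ℚ._≤_ (ℚ.+-identityˡ p) (-+-cancel p q) (ℚ.+-monoˡ-≤ p 0≤)

0<q-p⇒p<q : ∀ {p q} → 0ℚ ℚ.< q ℚ.- p → p ℚ.< q
0<q-p⇒p<q {p} {q} 0< = subst₂ ℚ._<_ (ℚ.+-identityˡ p) (-+-cancel p q) (ℚ.+-monoˡ-< p 0<)

0≤p*p : ∀ p → 0ℚ ℚ.≤ p ℚ.* p
0≤p*p p with ℚ.≤-total 0ℚ p
... | inj₁ 0≤p = 0≤p ⊗ 0≤p
... | inj₂ p≤0 = subst (0ℚ ℚ.≤_) (solve 1 (λ p → (:- p) :* (:- p) := p :* p) refl p) (0≤-p ⊗ 0≤-p)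
  where
  0≤-p : 0ℚ ℚ.≤ ℚ.- p
  0≤-p = ℚ.neg-antimono-≤ p≤0

0<½ : 0ℚ ℚ.< ½
0<½ = ℚ.positive⁻¹ ½

0≤½ : 0ℚ ℚ.≤ ½
0≤½ = ℚ.<⇒≤ 0<½

halve : ∀ {ε} → 0ℚ ℚ.< ε → ∃[ h ] 0ℚ ℚ.< h × h ℚ.+ h ≡ ε
halve {ε} 0<ε = ε ℚ.* ½ , *-positive 0<ε 0<½
  , trans (sym (ℚ.*-distribˡ-+ ε ½ ½)) (ℚ.*-identityʳ ε)

gap : ∀ {p q} → p ℚ.< q → ∃[ ε ] 0ℚ ℚ.< ε × p ℚ.+ ε ℚ.< q
gap {p} {q} p<q = let m , p<m , m<q = ℚ.<-dense p<q in
  m ℚ.- p , p<q⇒0<q-p p<m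
  , subst (ℚ._< q) (solve 2 (λ p m → m := p :+ (m :- p)) refl p m) m<q

small-factor : ∀ {B ε} → 0ℚ ℚ.< B → 0ℚ ℚ.< ε →
  ∃[ δ ] 0ℚ ℚ.< δ × δ ℚ.≤ 1ℚ × B ℚ.* δ ℚ.≤ ε
small-factor {B} {ε} 0<B 0<ε = δ , 0<δ
  , ℚ.*-cancelˡ-≤-pos A {{ℚ.positive 0<A}}
      (subst₂ ℚ._≤_ (sym Aδ≡ε) (sym (ℚ.*-identityʳ A)) ε≤A)
  , 0≤q-p⇒p≤q (subst (0ℚ ℚ.≤_) εδ≡ (ℚ.<⇒≤ (*-positive 0<ε 0<δ)))
  where
  A = B ℚ.+ ε
  0<A : 0ℚ ℚ.< A
  0<A = ℚ.+-mono-< 0<B 0<ε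
  A≢0 = ℚ.pos⇒nonZero A {{ℚ.positive 0<A}}
  -- Solving `(B + ε) δ = ε` gives `δ ≤ 1` and `B δ ≤ ε` at once, without a minimum.
  δ = ℚ.1/_ A {{A≢0}} ℚ.* ε
  0<δ : 0ℚ ℚ.< δ
  0<δ = *-positive {p = ℚ.1/_ A {{A≢0}}} (ℚ.positive⁻¹ _ {{ℚ.1/pos⇒pos A {{ℚ.positive 0<A}}}}) 0<ε
  Aδ≡ε : A ℚ.* δ ≡ ε
  Aδ≡ε = trans (sym (ℚ.*-assoc A _ ε))
    (trans (cong (ℚ._* ε) (ℚ.*-inverseʳ A {{A≢0}})) (ℚ.*-identityˡ ε))
  ε≤A : ε ℚ.≤ A
  ε≤A = subst (ℚ._≤ A) (ℚ.+-identityˡ ε) (ℚ.+-monoˡ-≤ ε (ℚ.<⇒≤ 0<B))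
  εδ≡ : ε ℚ.* δ ≡ ε ℚ.- B ℚ.* δ
  εδ≡ = trans (solve 3 (λ B ε δ → ε :* δ := (B :+ ε) :* δ :- B :* δ) refl B ε δ)
    (cong (ℚ._- B ℚ.* δ) Aδ≡ε)

p≤∣p∣ : ∀ p → p ℚ.≤ ℚ.∣ p ∣
p≤∣p∣ p with ℚ.≤-total 0ℚ p
... | inj₁ 0≤p = ℚ.≤-reflexive (sym (ℚ.0≤p⇒∣p∣≡p 0≤p))
... | inj₂ p≤0 = ℚ.≤-trans p≤0 (ℚ.0≤∣p∣ p)

Within : ℚ → ℚ → Set
Within δ p = 0ℚ ℚ.≤ δ ℚ.+ p × 0ℚ ℚ.≤ δ ℚ.- p

∣∣<⇒within : ∀ {δ p} → ℚ.∣ p ∣ ℚ.< δ → Within δ p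
∣∣<⇒within {δ} {p} ∣p∣<δ =
    subst (λ q → 0ℚ ℚ.≤ δ ℚ.+ q) (solve 1 (λ p → :- (:- p) := p) refl p)
      (p≤q⇒0≤q-p (ℚ.≤-trans (p≤∣p∣ (ℚ.- p)) (subst (ℚ._≤ δ) (sym (ℚ.∣-p∣≡∣p∣ p)) (ℚ.<⇒≤ ∣p∣<δ))))
  , p≤q⇒0≤q-p (ℚ.≤-trans (p≤∣p∣ p) (ℚ.<⇒≤ ∣p∣<δ))

p*p≤q*q⇒p≤q : ∀ {p q} → 0ℚ ℚ.< q → p ℚ.* p ℚ.≤ q ℚ.* q → p ℚ.≤ q
p*p≤q*q⇒p≤q {p} {q} 0<q p²≤q² = ℚ.≮⇒≥ λ q<p → ℚ.<-irrefl refl (ℚ.<-≤-trans (0<q-p⇒p<q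
  (subst (0ℚ ℚ.<_) (solve 2 (λ p q → (p :- q) :* (p :+ q) := p :* p :- q :* q) refl p q)
    (*-positive (p<q⇒0<q-p q<p) (ℚ.+-mono-< (ℚ.<-trans 0<q q<p) 0<q)))) p²≤q²)

p*p≤q*q⇒within : ∀ {p q} → 0ℚ ℚ.< q → p ℚ.* p ℚ.≤ q ℚ.* q → Within q p
p*p≤q*q⇒within {p} {q} 0<q p²≤q² =
    subst (λ r → 0ℚ ℚ.≤ q ℚ.+ r) (solve 1 (λ p → :- (:- p) := p) refl p)
      (p≤q⇒0≤q-p (p*p≤q*q⇒p≤q 0<q
        (subst (ℚ._≤ q ℚ.* q) (solve 1 (λ p → p :* p := (:- p) :* (:- p)) refl p) p²≤q²)))
  , p≤q⇒0≤q-p (p*p≤q*q⇒p≤q 0<q p²≤q²)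

3ℚ : ℚ
3ℚ = 1ℚ ℚ.+ 1ℚ ℚ.+ 1ℚ

-- The shift changes the square by at most `δ (p² + 1) + δ²` and the height by at most `δ`. As
-- `δ ≤ 1`, the loss is at most `δ (p² + 3) ≤ B δ ≤ h`, half of the gap.
parabola-stable : ∀ {p q p′ q′ h δ B} →
  p ℚ.* p ℚ.+ (h ℚ.+ h) ℚ.< q → 0ℚ ℚ.< δ → δ ℚ.≤ 1ℚ →
  p ℚ.* p ℚ.+ 3ℚ ℚ.< B → B ℚ.* δ ℚ.≤ h →
  Within δ (p′ ℚ.- p) → Within δ (q′ ℚ.- q) → p′ ℚ.* p′ ℚ.+ h ℚ.< q′
parabola-stable {p} {q} {p′} {q′} {h} {δ} {B} above 0<δ δ≤1 <B Bδ≤h (a₁ , a₂) (b₁ , _) =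
  0<q-p⇒p<q (subst (0ℚ ℚ.<_) identity
    (p<q⇒0<q-p above
      ⊞ p≤q⇒0≤q-p Bδ≤h
      ⊞ 0≤δ ⊗ p≤q⇒0≤q-p (ℚ.<⇒≤ <B)
      ⊞ b₁
      -- 2 p a ≤ δ (p² + 1) for a = p′ − p
      ⊞ 0≤½ ⊗ (a₁ ⊗ 0≤p*p (p ℚ.- 1ℚ) ⊕ a₂ ⊗ 0≤p*p (p ℚ.+ 1ℚ))
      ⊞ (a₂ ⊗ a₁ ⊕ 0≤δ ⊗ p≤q⇒0≤q-p δ≤1)))
  where
  0≤δ = ℚ.<⇒≤ 0<δ
  identity : _ ≡ q′ ℚ.- (p′ ℚ.* p′ ℚ.+ h)
  identity = solve 7 (λ p q p′ q′ h δ B →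
    let a = p′ :- p ; b = q′ :- q ; one = con 1ℚ in
    (q :- (p :* p :+ (h :+ h))) :+ (h :- B :* δ) :+ δ :* (B :- (p :* p :+ con 3ℚ)) :+ (δ :+ b)
      :+ con ½ :* ((δ :+ a) :* ((p :- one) :* (p :- one)) :+ (δ :- a) :* ((p :+ one) :* (p :+ one)))
      :+ ((δ :- a) :* (δ :+ a) :+ δ :* (one :- δ))
    := q′ :- (p′ :* p′ :+ h)) refl p q p′ q′ h δ B

-- For a real t with 0 ≤ t ≤ 1 the terms of its Cauchy sequence are only eventually in
-- [−η, 1 + η]; the slack of h absorbs this excursion.
combination-positive : ∀ {u v D t η h B} →
  h ℚ.+ h ℚ.< u → h ℚ.+ h ℚ.< v → 0ℚ ℚ.≤ D → 0ℚ ℚ.< h → 0ℚ ℚ.< η → η ℚ.≤ 1ℚ →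
  u ℚ.+ v ℚ.+ (D ℚ.+ D) ℚ.< B → B ℚ.* η ℚ.≤ h →
  0ℚ ℚ.≤ t ℚ.+ η → t ℚ.≤ 1ℚ ℚ.+ η →
  h ℚ.< (1ℚ ℚ.- t) ℚ.* u ℚ.+ t ℚ.* v ℚ.+ t ℚ.* (1ℚ ℚ.- t) ℚ.* D
combination-positive {u} {v} {D} {t} {η} {h} {B} <u <v 0≤D 0<h 0<η η≤1 <B Bη≤h 0≤t t≤1 =
  0<q-p⇒p<q (subst (0ℚ ℚ.<_) identity
    (*-positive 0<η (p<q⇒0<q-p <B)
      ⊞ p≤q⇒0≤q-p Bη≤h
      ⊞ p≤q⇒0≤q-p t≤1 ⊗ p≤q⇒0≤q-p (ℚ.<⇒≤ <u)
      ⊞ 0≤t ⊗ p≤q⇒0≤q-p (ℚ.<⇒≤ <v)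
      ⊞ 0≤t ⊗ p≤q⇒0≤q-p t≤1 ⊗ 0≤D
      ⊞ 0≤η ⊗ p≤q⇒0≤q-p η≤1 ⊗ 0≤D
      ⊞ 0≤η ⊗ ((0≤h ⊕ 0≤h) ⊕ (0≤h ⊕ 0≤h))))
  where
  0≤η = ℚ.<⇒≤ 0<η
  0≤h = ℚ.<⇒≤ 0<h
  identity : _ ≡ (1ℚ ℚ.- t) ℚ.* u ℚ.+ t ℚ.* v ℚ.+ t ℚ.* (1ℚ ℚ.- t) ℚ.* D ℚ.- h
  identity = solve 7 (λ u v D t η h B →
    let one = con 1ℚ ; t⁺ = t :+ η ; t⁻ = one :+ η :- t in
    η :* (B :- (u :+ v :+ (D :+ D))) :+ (h :- B :* η) :+ t⁻ :* (u :- (h :+ h)) :+ t⁺ :* (v :- (h :+ h))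
      :+ t⁺ :* t⁻ :* D :+ η :* (one :- η) :* D :+ η :* ((h :+ h) :+ (h :+ h))
    := (one :- t) :* u :+ t :* v :+ t :* (one :- t) :* D :- h) refl u v D t η h B

-- Squaring is convex with an exact defect: the excess of a combination over the parabola is the
-- combination of the excesses plus `t (1 − t) D`.
above-combination : ∀ {x₀ x₁ y₀ y₁ t h} →
  let D = (x₀ ℚ.- y₀) ℚ.* (x₀ ℚ.- y₀)
      z₀ = (1ℚ ℚ.- t) ℚ.* x₀ ℚ.+ t ℚ.* y₀
      z₁ = (1ℚ ℚ.- t) ℚ.* x₁ ℚ.+ t ℚ.* y₁ in
  h ℚ.< (1ℚ ℚ.- t) ℚ.* (x₁ ℚ.- x₀ ℚ.* x₀) ℚ.+ t ℚ.* (y₁ ℚ.- y₀ ℚ.* y₀)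
          ℚ.+ t ℚ.* (1ℚ ℚ.- t) ℚ.* D →
  z₀ ℚ.* z₀ ℚ.+ h ℚ.< z₁
above-combination {x₀} {x₁} {y₀} {y₁} {t} {h} h< =
  0<q-p⇒p<q (subst (0ℚ ℚ.<_) identity (p<q⇒0<q-p h<))
  where
  z₀ = (1ℚ ℚ.- t) ℚ.* x₀ ℚ.+ t ℚ.* y₀
  identity : _ ≡ (1ℚ ℚ.- t) ℚ.* x₁ ℚ.+ t ℚ.* y₁ ℚ.- (z₀ ℚ.* z₀ ℚ.+ h)
  identity = solve 6 (λ x₀ x₁ y₀ y₁ t h →
    let s = con 1ℚ :- t ; D = (x₀ :- y₀) :* (x₀ :- y₀) ; z₀ = s :* x₀ :+ t :* y₀ in
    s :* (x₁ :- x₀ :* x₀) :+ t :* (y₁ :- y₀ :* y₀) :+ t :* s :* D :- h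
    := s :* x₁ :+ t :* y₁ :- (z₀ :* z₀ :+ h)) refl x₀ x₁ y₀ y₁ t h

-- normal · (x , y) for the chord line through (a, a²) and (b, b²), whose offset is a b, in
-- the form to which the dot product of Defs evaluates.
chord : ℚ → ℚ → ℚ → ℚ → ℚ
chord a b x y = (a ℚ.+ b) ℚ.* x ℚ.+ (ℚ.- 1ℚ ℚ.* y ℚ.+ 0ℚ)

chord-excess : ∀ a b x y →
  chord a b x y ℚ.- a ℚ.* b ≡ (x ℚ.- a) ℚ.* (b ℚ.- x) ℚ.- (y ℚ.- x ℚ.* x)
chord-excess = solve 4 (λ a b x y →
  (a :+ b) :* x :+ (con (ℚ.- 1ℚ) :* y :+ con 0ℚ) :- a :* b
  := (x :- a) :* (b :- x) :- (y :- x :* x)) refl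

-- Above the parabola, a point of the cap has `(x − a)(b − x) > 0`, which for `a ≤ b` fails on both
-- sides of the interval.
cap-between : ∀ {a b x y} → a ℚ.≤ b → x ℚ.* x ℚ.< y → a ℚ.* b ℚ.< chord a b x y → a ℚ.< x × x ℚ.< b
cap-between {a} {b} {x} {y} a≤b x²<y in-ab = ℚ.≰⇒> x≰a , ℚ.≰⇒> b≰x
  where
  0<excess : 0ℚ ℚ.< (x ℚ.- a) ℚ.* (b ℚ.- x)
  0<excess = subst (0ℚ ℚ.<_) (-+-cancel (y ℚ.- x ℚ.* x) _)
    (ℚ.+-mono-< (subst (0ℚ ℚ.<_) (chord-excess a b x y) (p<q⇒0<q-p in-ab)) (p<q⇒0<q-p x²<y))
  impossible : ∀ {p} → 0ℚ ℚ.≤ p → ¬ p ≡ ℚ.- ((x ℚ.- a) ℚ.* (b ℚ.- x))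
  impossible 0≤p refl = ℚ.<-irrefl refl (ℚ.<-≤-trans (ℚ.neg-antimono-< 0<excess) 0≤p)
  x≰a : ¬ x ℚ.≤ a
  x≰a x≤a = impossible (p≤q⇒0≤q-p x≤a ⊗ p≤q⇒0≤q-p (ℚ.≤-trans x≤a a≤b))
    (solve 3 (λ a b x → (a :- x) :* (b :- x) := :- ((x :- a) :* (b :- x))) refl a b x)
  b≰x : ¬ b ℚ.≤ x
  b≰x b≤x = impossible (p≤q⇒0≤q-p (ℚ.≤-trans a≤b b≤x) ⊗ p≤q⇒0≤q-p b≤x)
    (solve 3 (λ a b x → (x :- a) :* (x :- b) := :- ((x :- a) :* (b :- x))) refl a b x)

caps-disjoint : ∀ {a b c d x y} → a ℚ.≤ b → b ℚ.≤ c → c ℚ.≤ d → x ℚ.* x ℚ.< y →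
  a ℚ.* b ℚ.< chord a b x y → ¬ c ℚ.* d ℚ.< chord c d x y
caps-disjoint a≤b b≤c c≤d above in₁ in₂ = ℚ.<-irrefl refl
  (ℚ.<-trans (proj₂ (cap-between a≤b above in₁)) (ℚ.≤-<-trans b≤c (proj₁ (cap-between c≤d above in₂))))

-- Expanding `x − a = (x − c) + (c − a)` and `b − x = (d − x) + (b − d)` shows that `(x − a)(b − x)`
-- exceeds `(x − c)(d − x)` by three nonnegative products.
caps-nested : ∀ {a b c d x y} → a ℚ.≤ c → c ℚ.≤ d → d ℚ.≤ b → x ℚ.* x ℚ.< y →
  c ℚ.* d ℚ.< chord c d x y → ¬ chord a b x y ℚ.< a ℚ.* b
caps-nested {a} {b} {c} {d} {x} {y} a≤c c≤d d≤b above in-cd out-ab =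
  let c<x , x<d = cap-between c≤d above in-cd
      0≤x-c = p≤q⇒0≤q-p (ℚ.<⇒≤ c<x)
      0≤d-x = p≤q⇒0≤q-p (ℚ.<⇒≤ x<d)
      0≤c-a = p≤q⇒0≤q-p a≤c
      0≤b-d = p≤q⇒0≤q-p d≤b
  in ℚ.<-irrefl refl (subst (0ℚ ℚ.<_) identity
       (p<q⇒0<q-p in-cd ⊞ (0≤x-c ⊗ 0≤b-d ⊕ 0≤c-a ⊗ 0≤d-x ⊕ 0≤c-a ⊗ 0≤b-d) ⊞ ℚ.<⇒≤ (p<q⇒0<q-p out-ab)))
  where
  identity : _ ≡ 0ℚ
  identity = solve 6 (λ a b c d x y →
    let ch = λ a b → (a :+ b) :* x :+ (con (ℚ.- 1ℚ) :* y :+ con 0ℚ) in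
    (ch c d :- c :* d) :+ ((x :- c) :* (b :- d) :+ (c :- a) :* (d :- x) :+ (c :- a) :* (b :- d))
      :+ (a :* b :- ch a b) := con 0ℚ) refl a b c d x y

-- Chords and sites at integers

ι : ℕ → ℚ
ι zero    = 0ℚ
ι (suc n) = 1ℚ ℚ.+ ι n

0≤ι : ∀ n → 0ℚ ℚ.≤ ι n
0≤ι zero    = ℚ.≤-refl
0≤ι (suc n) = ℚ.<⇒≤ (ℚ.positive⁻¹ 1ℚ) ⊕ 0≤ι n

ι-mono : ∀ {m n} → m ℕ.≤ n → ι m ℚ.≤ ι n
ι-mono {n = n} ℕ.z≤n = 0≤ι n
ι-mono (ℕ.s≤s m≤n)   = ℚ.+-monoʳ-≤ 1ℚ (ι-mono m≤n)

-- At an integer strictly between the endpoints `(s − l)(r − s)` is at least 1, and at any other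
-- integer at most 0; the height ½ above the parabola separates the two cases.
inside-cap : ∀ {l s r} → l ℕ.< s → s ℕ.< r →
  ι l ℚ.* ι r ℚ.< chord (ι l) (ι r) (ι s) (ι s ℚ.* ι s ℚ.+ ½)
inside-cap {l} {s} {r} l<s s<r = 0<q-p⇒p<q (subst (0ℚ ℚ.<_) (identity (ι l) (ι s) (ι r))
  (0<½ ⊞ 0≤α ⊞ 0≤β ⊞ 0≤α ⊗ 0≤β))
  where
  0≤α = p≤q⇒0≤q-p (ι-mono l<s)
  0≤β = p≤q⇒0≤q-p (ι-mono s<r)
  identity : ∀ l s r → let α = s ℚ.- (1ℚ ℚ.+ l) ; β = r ℚ.- (1ℚ ℚ.+ s) in
    ½ ℚ.+ α ℚ.+ β ℚ.+ α ℚ.* β ≡ chord l r s (s ℚ.* s ℚ.+ ½) ℚ.- l ℚ.* r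
  identity = solve 3 (λ l s r → let α = s :- (con 1ℚ :+ l) ; β = r :- (con 1ℚ :+ s) in
    con ½ :+ α :+ β :+ α :* β
    := (l :+ r) :* s :+ (con (ℚ.- 1ℚ) :* (s :* s :+ con ½) :+ con 0ℚ) :- l :* r) refl

outside-cap : ∀ {l s r} → l ℕ.≤ r → s ℕ.≤ l ⊎ r ℕ.≤ s →
  chord (ι l) (ι r) (ι s) (ι s ℚ.* ι s ℚ.+ ½) ℚ.< ι l ℚ.* ι r
outside-cap {l} {s} {r} l≤r s∉lr = 0<q-p⇒p<q (subst (0ℚ ℚ.<_) (identity (ι l) (ι s) (ι r))
  (0<½ ⊞ same-side s∉lr))
  where
  same-side : s ℕ.≤ l ⊎ r ℕ.≤ s → 0ℚ ℚ.≤ (ι l ℚ.- ι s) ℚ.* (ι r ℚ.- ι s)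
  same-side (inj₁ s≤l) = p≤q⇒0≤q-p (ι-mono s≤l) ⊗ p≤q⇒0≤q-p (ι-mono (ℕ.≤-trans s≤l l≤r))
  same-side (inj₂ r≤s) = subst (0ℚ ℚ.≤_)
    (solve 3 (λ l s r → (s :- l) :* (s :- r) := (l :- s) :* (r :- s)) refl (ι l) (ι s) (ι r))
    (p≤q⇒0≤q-p (ι-mono (ℕ.≤-trans l≤r r≤s)) ⊗ p≤q⇒0≤q-p (ι-mono r≤s))
  identity : ∀ l s r → ½ ℚ.+ (l ℚ.- s) ℚ.* (r ℚ.- s) ≡ l ℚ.* r ℚ.- chord l r s (s ℚ.* s ℚ.+ ½)
  identity = solve 3 (λ l s r → con ½ :+ (l :- s) :* (r :- s)
    := l :* r :- ((l :+ r) :* s :+ (con (ℚ.- 1ℚ) :* (s :* s :+ con ½) :+ con 0ℚ))) refl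

-- The region above the parabola

Eventually : (ℕ → Set) → Set
Eventually P = ∃[ N ] (∀ n → N ℕ.≤ n → P n)

eventually-× : ∀ {P Q} → Eventually P → Eventually Q → Eventually (λ n → P n × Q n)
eventually-× (M , p) (N , q) = M ℕ.⊔ N , λ n M⊔N≤n →
  p n (ℕ.m⊔n≤o⇒m≤o M N M⊔N≤n) , q n (ℕ.m⊔n≤o⇒n≤o M N M⊔N≤n)

eventually-map : ∀ {P Q} → (∀ {n} → P n → Q n) → Eventually P → Eventually Q
eventually-map f (N , p) = N , λ n N≤n → f (p n N≤n)

witness : ∀ {P} → Eventually P → ∃ P
witness (N , p) = N , p N ℕ.≤-refl

<⇒eventually : ∀ {x y} → x < y → Eventually (λ n → seq x n ℚ.< seq y n)
<⇒eventually {x} {y} (ε , 0<ε , N , lt) = N , λ n N≤n → ℚ.<-trans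
  (subst (ℚ._< seq x n ℚ.+ ε) (ℚ.+-identityʳ (seq x n)) (ℚ.+-monoʳ-< (seq x n) 0<ε)) (lt n N≤n)

constant-< : ∀ x y {p q} → (∀ n → seq x n ≡ p) → (∀ n → seq y n ≡ q) → p ℚ.< q → x < y
constant-< x y x≡p y≡q p<q = let ε , 0<ε , p+ε<q = gap p<q in
  ε , 0<ε , 0 , λ n _ → subst₂ (λ p q → p ℚ.+ ε ℚ.< q) (sym (x≡p n)) (sym (y≡q n)) p+ε<q

bounded-above : ∀ x → ∃[ B ] 0ℚ ℚ.< B × Eventually (λ n → seq x n ℚ.< B)
bounded-above x with cauchy x 1ℚ (ℚ.positive⁻¹ 1ℚ)
... | N , close = 1ℚ ℚ.+ ℚ.∣ seq x N ∣
  , ℚ.+-mono-<-≤ (ℚ.positive⁻¹ 1ℚ) (ℚ.0≤∣p∣ (seq x N))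
  , N , λ n N≤n → subst (ℚ._< 1ℚ ℚ.+ ℚ.∣ seq x N ∣)
      (solve 2 (λ a b → (a :- b) :+ b := a) refl (seq x n) (seq x N))
      (ℚ.+-mono-<-≤ (ℚ.≤-<-trans (p≤∣p∣ _) (close n N N≤n ℕ.≤-refl)) (p≤∣p∣ (seq x N)))

-- `x ≤ y` is only a negation, but one rational term of `x - y` decides. If it exceeds `η / 2`,
-- closeness within `η / 4` leaves a uniform gap, so `y < x`; otherwise later terms stay below `η`.
≤⇒eventually : ∀ {x y η} → x ≤ y → 0ℚ ℚ.< η → Eventually (λ n → seq x n ℚ.≤ seq y n ℚ.+ η)
≤⇒eventually {x} {y} x≤y 0<η
  with h , 0<h , refl ← halve 0<η
  with k , 0<k , refl ← halve 0<h
  with N , close ← cauchy (x - y) k 0<k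
  with seq (x - y) N ℚ.≤? k ℚ.+ k
... | yes d≤2k = N , λ n N≤n → 0≤q-p⇒p≤q (subst (0ℚ ℚ.≤_)
  (solve 4 (λ a b d k → k :- ((a :- b) :- d) :+ ((k :+ k) :- d) :+ k
                        := b :+ ((k :+ k) :+ (k :+ k)) :- a)
    refl (seq x n) (seq y n) (seq (x - y) N) k)
  (p≤q⇒0≤q-p (ℚ.<⇒≤ (ℚ.≤-<-trans (p≤∣p∣ _) (close n N N≤n ℕ.≤-refl)))
    ⊕ p≤q⇒0≤q-p d≤2k ⊕ ℚ.<⇒≤ 0<k))
... | no  d≰2k = contradiction (k , 0<k , N , λ n N≤n → 0<q-p⇒p<q (subst (0ℚ ℚ.<_)
  (solve 4 (λ a b d k → k :- (d :- (a :- b)) :+ (d :- (k :+ k)) := a :- (b :+ k))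
    refl (seq x n) (seq y n) (seq (x - y) N) k)
  (ℚ.+-mono-< (p<q⇒0<q-p (ℚ.≤-<-trans (p≤∣p∣ _) (close N n ℕ.≤-refl N≤n)))
    (p<q⇒0<q-p (ℚ.≰⇒> d≰2k))))) x≤y

Parabola : PointSet 2
Parabola x = x 0F * x 0F < x 1F

-- One gap `h` serves all rational points near the terms of `x`; extensionality and openness both
-- follow by applying it termwise.
parabola-neighbourhood : ∀ {x} → Parabola x → ∃[ h ] ∃[ δ ] 0ℚ ℚ.< h × 0ℚ ℚ.< δ ×
  Eventually (λ n → ∀ p q → Within δ (p ℚ.- seq (x 0F) n) → Within δ (q ℚ.- seq (x 1F) n) →
    p ℚ.* p ℚ.+ h ℚ.< q)
parabola-neighbourhood {x} (ε , 0<ε , above) =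
  let h , 0<h , h+h≡ε      = halve 0<ε
      B , 0<B , below      = bounded-above (x 0F * x 0F + fromℚ 3ℚ)
      δ , 0<δ , δ≤1 , Bδ≤h = small-factor 0<B 0<h
  in h , δ , 0<h , 0<δ , eventually-map
       (λ {n} (above , below) p q → parabola-stable {seq (x 0F) n} {seq (x 1F) n} {p} {q} {h} {δ} {B}
         (subst (λ r → seq (x 0F) n ℚ.* seq (x 0F) n ℚ.+ r ℚ.< seq (x 1F) n) (sym h+h≡ε) above)
         0<δ δ≤1 below Bδ≤h)
       (eventually-× above below)

parabola-extensional : Extensional Parabola
parabola-extensional {x} {y} x≈y Kx =
  let h , δ , 0<h , 0<δ , stable = parabola-neighbourhood {x} Kx
      close i = x≈y i δ 0<δ
  in h , 0<h , eventually-map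
       (λ {n} (stable , c₀ , c₁) →
         stable (seq (y 0F) n) (seq (y 1F) n) (reverse n 0F c₀) (reverse n 1F c₁))
       (eventually-× stable (eventually-× (close 0F) (close 1F)))
  where
  reverse : ∀ {δ} n i → ℚ.∣ seq (x i) n ℚ.- seq (y i) n ∣ ℚ.< δ →
    Within δ (seq (y i) n ℚ.- seq (x i) n)
  reverse {δ} n i c = ∣∣<⇒within (subst (ℚ._< δ)
    (trans (sym (ℚ.∣-p∣≡∣p∣ (seq (x i) n ℚ.- seq (y i) n)))
      (cong ℚ.∣_∣ (solve 2 (λ a b → :- (a :- b) := b :- a) refl (seq (x i) n) (seq (y i) n)))) c)

parabola-open : RelativelyOpen Parabola
parabola-open {x} Kx =
  let h , δ , 0<h , 0<δ , stable = parabola-neighbourhood {x} Kx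
  in fromℚ δ , constant-< 0ℝ (fromℚ δ) (λ _ → refl) (λ _ → refl) 0<δ , λ {y} _ near →
       h , 0<h , eventually-map
         (λ {n} (stable , near) →
           let a = seq (y 0F) n ℚ.- seq (x 0F) n
               b = seq (y 1F) n ℚ.- seq (x 1F) n
           in stable (seq (y 0F) n) (seq (y 1F) n)
             (p*p≤q*q⇒within {a} 0<δ (summand (b ℚ.* b) (0≤p*p b) (ℚ.<⇒≤ near)
               (solve 2 (λ a b → (a :+ (b :+ con 0ℚ)) := a :+ b) refl (a ℚ.* a) (b ℚ.* b))))
             (p*p≤q*q⇒within {b} 0<δ (summand (a ℚ.* a) (0≤p*p a) (ℚ.<⇒≤ near)
               (solve 2 (λ a b → (a :+ (b :+ con 0ℚ)) := b :+ a) refl (a ℚ.* a) (b ℚ.* b)))))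
         (eventually-× stable (<⇒eventually {dist² y x} {fromℚ δ * fromℚ δ} near))
  where
  summand : ∀ {p r s} q → 0ℚ ℚ.≤ q → s ℚ.≤ r → s ≡ p ℚ.+ q → p ℚ.≤ r
  summand {p} q 0≤q s≤r refl = ℚ.≤-trans
    (subst (ℚ._≤ p ℚ.+ q) (ℚ.+-identityʳ p) (ℚ.+-monoʳ-≤ p 0≤q)) s≤r

⊓-positive : ∀ {p q} → 0ℚ ℚ.< p → 0ℚ ℚ.< q → 0ℚ ℚ.< p ℚ.⊓ q
⊓-positive {p} {q} 0<p 0<q with ℚ.≤-total p q
... | inj₁ p≤q = subst (0ℚ ℚ.<_) (sym (ℚ.p≤q⇒p⊓q≡p p≤q)) 0<p
... | inj₂ q≤p = subst (0ℚ ℚ.<_) (sym (ℚ.p≥q⇒p⊓q≡q q≤p)) 0<q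

parabola-excess : ∀ {h p q ε} → h ℚ.+ h ℚ.≤ ε → p ℚ.* p ℚ.+ ε ℚ.< q → h ℚ.+ h ℚ.< q ℚ.- p ℚ.* p
parabola-excess {p = p} {q} {ε} 2h≤ε lt = ℚ.≤-<-trans 2h≤ε (0<q-p⇒p<q (subst (0ℚ ℚ.<_)
  (solve 3 (λ p q e → q :- (p :* p :+ e) := q :- p :* p :- e) refl p q ε) (p<q⇒0<q-p lt)))

parabola-convex : Convex Parabola
parabola-convex {x} {y} (ε₁ , 0<ε₁ , above-x) (ε₂ , 0<ε₂ , above-y) t 0≤t t≤1 =
  let h , 0<h , h+h≡ε      = halve (⊓-positive 0<ε₁ 0<ε₂)
      2h≤ε₁ : h ℚ.+ h ℚ.≤ ε₁
      2h≤ε₁                = ℚ.≤-trans (ℚ.≤-reflexive h+h≡ε) (ℚ.p⊓q≤p ε₁ ε₂)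
      2h≤ε₂ : h ℚ.+ h ℚ.≤ ε₂
      2h≤ε₂                = ℚ.≤-trans (ℚ.≤-reflexive h+h≡ε) (ℚ.p⊓q≤q ε₁ ε₂)
      -- The summand `D` is doubled because, for `t` in `[−η, 1 + η]` and `η ≤ 1`, the factor
      -- `t (1 − t)` can fall as low as `−2 η`.
      B , 0<B , below      = bounded-above
        (x 1F - x 0F * x 0F + (y 1F - y 0F * y 0F)
          + ((x 0F - y 0F) * (x 0F - y 0F) + (x 0F - y 0F) * (x 0F - y 0F)))
      η , 0<η , η≤1 , Bη≤h = small-factor 0<B 0<h
  in h , 0<h , eventually-map
      (λ {n} ((above-x , above-y) , below , 0≤t , t≤1) →
        above-combination {seq (x 0F) n} {seq (x 1F) n} {seq (y 0F) n} {seq (y 1F) n} {seq t n}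
          (combination-positive {h = h}
            (parabola-excess {h = h} {p = seq (x 0F) n} 2h≤ε₁ above-x)
            (parabola-excess {h = h} {p = seq (y 0F) n} 2h≤ε₂ above-y)
            (0≤p*p (seq (x 0F) n ℚ.- seq (y 0F) n)) 0<h 0<η η≤1 below Bη≤h 0≤t t≤1))
      (eventually-× (eventually-× above-x above-y)
        (eventually-× below
          (eventually-× (≤⇒eventually {0ℝ} {t} 0≤t 0<η) (≤⇒eventually {t} {1ℝ} t≤1 0<η))))

-- The planar realization

module _ {n : ℕ} (C : SetFamily n) (isTree : IsTree C) where

  open Intervals C isTree

  normal : Fin n → ℝ^ 2
  normal e = fromℚ (ι (left e) ℚ.+ ι (right e)) ∷ᶠ fromℚ (ℚ.- 1ℚ) ∷ᶠ []ᶠ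

  offset : Fin n → ℝ
  offset e = fromℚ (ι (left e) ℚ.* ι (right e))

  -- Oriented so that the positive side is below the chord and cuts out the cap; the coefficient -1
  -- keeps the normal nonzero for degenerate intervals too.
  chordLine : Fin n → Hyperplane 2
  chordLine e = record
    { normal   = normal e
    ; offset   = offset e
    ; normal≠0 = 1F , inj₁ (constant-< (fromℚ (ℚ.- 1ℚ)) 0ℝ (λ _ → refl) (λ _ → refl)
        (ℚ.negative⁻¹ (ℚ.- 1ℚ)))
    }

  location : Subset n → ℝ^ 2
  location X = fromℚ (ι (site X)) ∷ᶠ fromℚ (ι (site X) ℚ.* ι (site X) ℚ.+ ½) ∷ᶠ []ᶠ

  location-above : ∀ X → Parabola (location X)
  location-above X = constant-< (location X 0F * location X 0F) (location X 1F)
    (λ _ → refl) (λ _ → refl)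
    (subst (ℚ._< s² ℚ.+ ½) (ℚ.+-identityʳ s²) (ℚ.+-monoʳ-< s² 0<½))
    where s² = ι (site X) ℚ.* ι (site X)

  location-⁺ : ∀ {X} → X ∈ᶠ C → ∀ e → e ∈ X → (chordLine e ⁺) (location X)
  location-⁺ {X} X∈C e e∈X = let l<s , s<r = site-inside X∈C e∈X in
    constant-< (offset e) (normal e · location X) (λ _ → refl) (λ _ → refl) (inside-cap l<s s<r)

  location-⁻ : ∀ {X} → X ∈ᶠ C → ∀ e → e ∉ X → (chordLine e ⁻) (location X)
  location-⁻ {X} X∈C e e∉X =
    constant-< (normal e · location X) (offset e) (λ _ → refl) (λ _ → refl)
      (outside-cap (left≤right e) (site-outside X∈C e∉X))

  signs⇒member : ∀ S x → Parabola x → (∀ e → e ∈ S → (chordLine e ⁺) x) →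
    (∀ e → e ∉ S → (chordLine e ⁻) x) → S ∈ᶠ C
  signs⇒member S x above in⁺ out⁻ = laminar⇒member S
    (λ {e} {f} e∈S f∈S r≤l →
      let _ , above , in-e , in-f = witness (eventually-× (<⇒eventually {x 0F * x 0F} {x 1F} above)
            (eventually-× (⁺⇒ e (in⁺ e e∈S)) (⁺⇒ f (in⁺ f f∈S))))
      in caps-disjoint (ι-mono (left≤right e)) (ι-mono r≤l) (ι-mono (left≤right f)) above in-e in-f)
    (λ {e} {f} e∈S f∉S (l≤l , r≤r) →
      let _ , above , in-e , out-f = witness (eventually-× (<⇒eventually {x 0F * x 0F} {x 1F} above)
            (eventually-× (⁺⇒ e (in⁺ e e∈S)) (⁻⇒ f (out⁻ f f∉S))))
      in caps-nested (ι-mono l≤l) (ι-mono (left≤right e)) (ι-mono r≤r) above in-e out-f)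
    where
    normal·x : Fin n → ℕ → ℚ
    normal·x e k = chord (ι (left e)) (ι (right e)) (seq (x 0F) k) (seq (x 1F) k)
    ⁺⇒ : ∀ e → (chordLine e ⁺) x → Eventually (λ k → ι (left e) ℚ.* ι (right e) ℚ.< normal·x e k)
    ⁺⇒ e = <⇒eventually {offset e} {normal e · x}
    ⁻⇒ : ∀ e → (chordLine e ⁻) x → Eventually (λ k → normal·x e k ℚ.< ι (left e) ℚ.* ι (right e))
    ⁻⇒ e = <⇒eventually {normal e · x} {offset e}

  planar : Realization C 2
  planar = record
    { H              = chordLine
    ; K              = Parabola
    ; extensional    = λ {x} {y} → parabola-extensional {x} {y}
    ; convex         = λ {x} {y} → parabola-convex {x} {y}
    ; relativelyOpen = λ {x} → parabola-open {x}
    ; realizes       = λ X → mk⇔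
        (λ X∈C → location X , location-above X , location-⁺ X∈C , location-⁻ X∈C)
        (λ (x , above , in⁺ , out⁻) → signs⇒member X x above in⁺ out⁻)
    }

proposition41 : ∀ (n : ℕ) (T : SetFamily n) → IsTree T →
    Realization T 2 × (∀ m → IsEuclideanDimension T m → m ℕ.≤ 2)
proposition41 n T isTree = planar T isTree , λ m (_ , minimal) → minimal 2 (planar T isTree)
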